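{- Let $\ell, r \geq 1$ be integers. Every finite simple transversal matroid of rank $r$ with no minor isomorphic to $U_{2,\ell+2}$ has at most $\ell(r-1)+1$ elements.
   Context: All matroids are finite. A matroid is simple if it has no loops and no parallel pairs. A minor of a matroid is a matroid obtained from it by a sequence of deletions and contractions. For integers $0 \leq k \leq m$, the uniform matroid $U_{k,m}$ is the matroid on an $m$-element ground set whose independent sets are precisely the subsets of size at most $k$. Transversal matroids: an indexed family $(P_1,\ldots,P_b)$ of subsets of a finite set $E$ (members may repeat, repeated members having distinct indices) presents the matroid on $E$ whose independent sets are precisely the sets $I \subseteq E$ admitting an injection $f : I \to \{1,\ldots,b\}$ with $x \in P_{f(x)}$ for every $x \in I$. A matroid having such a presentation is called transversal. -}

module Defs where

open import Data.Fin using (Fin)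
open import Data.Fin.Properties using (any?)
open import Data.Fin.Subset
open import Data.Fin.Subset.Properties
open import Data.Nat using (ℕ; zero; suc; _+_; _∸_; _≤_; _<_; _≤?_; z≤n; s≤s)
open import Data.Nat.Properties
open import Data.Product using (Σ; ∃; _×_; _,_; proj₁; proj₂)
open import Data.Sum using ([_,_]′)
open import Data.Vec using ([]; _∷_; here; there)
open import Function using (_∘_)
open import Function.Bundles using (_⇔_; _↔_; Inverse)
open import Function.Definitions using (Injective)
open import Level using (0ℓ)
open import Relation.Binary.Construct.Closure.ReflexiveTransitive using (Star)
open import Relation.Binary.PropositionalEquality
  using (_≡_; _≢_; sym; cong; subst)
open import Relation.Nullary using (¬_; Dec; yes; no; contradiction)
open import Relation.Nullary.Decidable using (_×-dec_; _→-dec_; ¬?; decidable-stable)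
open import Relation.Unary using (Pred; Decidable)

private
  variable
    n m : ℕ

-- The ground set is an arbitrary subset of Fin n, so that deletion and
-- contraction shrink it without relabelling the remaining elements.
-- Independence is decidable, as it is classically for any finite matroid.
record Matroid (n : ℕ) : Set₁ where
  field
    ground          : Subset n
    Indep           : Subset n → Set
    indep?          : Decidable Indep
    indep⊆ground    : ∀ {I} → Indep I → I ⊆ ground
    indep-⊥         : Indep ⊥
    indep-⊆         : ∀ {I J} → I ⊆ J → Indep J → Indep I
    indep-augment   : ∀ {I J} → Indep I → Indep J → ∣ I ∣ < ∣ J ∣ →
                      ∃ λ x → x ∈ J × x ∉ I × Indep (I ∪ ⁅ x ⁆)

open Matroid public

IsLoop : Matroid n → Fin n → Set
IsLoop M x = x ∈ ground M × ¬ Indep M ⁅ x ⁆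

IsParallelPair : Matroid n → Fin n → Fin n → Set
IsParallelPair M x y =
  x ≢ y × Indep M ⁅ x ⁆ × Indep M ⁅ y ⁆ × ¬ Indep M (⁅ x ⁆ ∪ ⁅ y ⁆)

IsSimple : Matroid n → Set
IsSimple M = (∀ x → ¬ IsLoop M x) × (∀ x y → ¬ IsParallelPair M x y)

IsBasisOf : Matroid n → Subset n → Subset n → Set
IsBasisOf M X B =
  Indep M B × B ⊆ X × (∀ J → Indep M J → B ⊆ J → J ⊆ X → J ⊆ B)

-- By basis-card below, at most one r satisfies this, and by basis-exists
-- at least one does.
HasRank : Matroid n → ℕ → Set
HasRank M r = ∃ λ B → IsBasisOf M (ground M) B × ∣ B ∣ ≡ r

∪-lub : {p q s : Subset n} → p ⊆ s → q ⊆ s → p ∪ q ⊆ s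
∪-lub {p = p} {q} p⊆s q⊆s x∈ = [ p⊆s , q⊆s ]′ (x∈p∪q⁻ p q x∈)

⁅⁆⊆ : {x : Fin n} {s : Subset n} → x ∈ s → ⁅ x ⁆ ⊆ s
⁅⁆⊆ {x = x} {s} x∈s y∈ = subst (_∈ s) (sym (x∈⁅y⁆⇒x≡y x y∈)) x∈s

∣∪∣≤ : (p q : Subset n) → ∣ p ∪ q ∣ ≤ ∣ p ∣ + ∣ q ∣
∣∪∣≤ []            []            = z≤n
∣∪∣≤ (outside ∷ p) (outside ∷ q) = ∣∪∣≤ p q
∣∪∣≤ (outside ∷ p) (inside  ∷ q) =
  ≤-trans (s≤s (∣∪∣≤ p q)) (≤-reflexive (sym (+-suc ∣ p ∣ ∣ q ∣)))
∣∪∣≤ (inside  ∷ p) (outside ∷ q) = s≤s (∣∪∣≤ p q)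
∣∪∣≤ (inside  ∷ p) (inside  ∷ q) =
  s≤s (≤-trans (∣∪∣≤ p q) (+-monoʳ-≤ ∣ p ∣ (n≤1+n ∣ q ∣)))

∣∪∣≥ : (p q : Subset n) → (∀ {x} → x ∈ p → x ∉ q) → ∣ p ∣ + ∣ q ∣ ≤ ∣ p ∪ q ∣
∣∪∣≥ []            []            dis = z≤n
∣∪∣≥ (outside ∷ p) (outside ∷ q) dis = ∣∪∣≥ p q λ a b → dis (there a) (there b)
∣∪∣≥ (outside ∷ p) (inside  ∷ q) dis =
  ≤-trans (≤-reflexive (+-suc ∣ p ∣ ∣ q ∣))
          (s≤s (∣∪∣≥ p q λ a b → dis (there a) (there b)))
∣∪∣≥ (inside  ∷ p) (outside ∷ q) dis = s≤s (∣∪∣≥ p q λ a b → dis (there a) (there b))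
∣∪∣≥ (inside  ∷ p) (inside  ∷ q) dis = contradiction here (dis here)

∈─⇒∉ : (p q : Subset n) {x : Fin n} → x ∈ p ─ q → x ∉ q
∈─⇒∉ (inside ∷ p) (outside ∷ q) here       ()
∈─⇒∉ (_      ∷ p) (outside ∷ q) (there x∈) (there x∈q) = ∈─⇒∉ p q x∈ x∈q
∈─⇒∉ (_      ∷ p) (inside  ∷ q) (there x∈) (there x∈q) = ∈─⇒∉ p q x∈ x∈q

allSubsets? : {P : Pred (Subset n) 0ℓ} → Decidable P → Dec (∀ J → P J)
allSubsets? P? with anySubset? (¬? ∘ P?)
... | yes (J , ¬PJ) = no λ ∀P → ¬PJ (∀P J)
... | no  ∄         = yes λ J → decidable-stable (P? J) λ ¬PJ → ∄ (J , ¬PJ)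

isBasisOf? : (M : Matroid n) (X : Subset n) → Decidable (IsBasisOf M X)
isBasisOf? M X B =
  indep? M B ×-dec (B ⊆? X) ×-dec
  allSubsets? λ J → indep? M J →-dec ((B ⊆? J) →-dec ((J ⊆? X) →-dec (J ⊆? B)))

module _ (M : Matroid n) (X : Subset n) where

  private
    extend : ∀ k {I} → n ∸ ∣ I ∣ ≤ k → Indep M I → I ⊆ X →
             ∃ λ B → IsBasisOf M X B × I ⊆ B
    extend k {I} bound indI I⊆X
      with any? (λ x → (x ∈? X) ×-dec ¬? (x ∈? I) ×-dec indep? M (I ∪ ⁅ x ⁆))
    ... | no ∄ = I , (indI , I⊆X , maximal) , λ x∈ → x∈
      where
      maximal : ∀ J → Indep M J → I ⊆ J → J ⊆ X → J ⊆ I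
      maximal J indJ I⊆J J⊆X {x} x∈J with x ∈? I
      ... | yes x∈I = x∈I
      ... | no  x∉I = contradiction
        (x , J⊆X x∈J , x∉I , indep-⊆ M (∪-lub I⊆J (⁅⁆⊆ x∈J)) indJ) ∄
    ... | yes (x , x∈X , x∉I , ind) = step k bound
      where
      I< : ∣ I ∣ < ∣ I ∪ ⁅ x ⁆ ∣
      I< = p⊂q⇒∣p∣<∣q∣
        (p⊆p∪q ⁅ x ⁆ , x , q⊆p∪q I ⁅ x ⁆ (x∈⁅x⁆ x) , x∉I)
      I<n : ∣ I ∣ < n
      I<n = <-≤-trans I< (∣p∣≤n (I ∪ ⁅ x ⁆))
      step : ∀ k → n ∸ ∣ I ∣ ≤ k → ∃ λ B → IsBasisOf M X B × I ⊆ B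
      step zero    b = contradiction (m<n⇒0<n∸m I<n) (≤⇒≯ b)
      step (suc k) b
        with extend k (≤-pred (<-≤-trans (∸-monoʳ-< I< (∣p∣≤n (I ∪ ⁅ x ⁆))) b))
                    ind (∪-lub I⊆X (⁅⁆⊆ x∈X))
      ... | B , basis , I⁺⊆B = B , basis , λ y∈I → I⁺⊆B (p⊆p∪q ⁅ x ⁆ y∈I)

  basis-extend : ∀ {I} → Indep M I → I ⊆ X → ∃ λ B → IsBasisOf M X B × I ⊆ B
  basis-extend {I} = extend (n ∸ ∣ I ∣) ≤-refl

  basis-exists : ∃ (IsBasisOf M X)
  basis-exists with basis-extend (indep-⊥ M) (⊆-min X)
  ... | B , basis , _ = B , basis

  basis-∌ : ∀ {B x} → IsBasisOf M X B → x ∈ X → x ∉ B → ¬ Indep M (B ∪ ⁅ x ⁆)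
  basis-∌ {B} {x} (_ , B⊆X , max) x∈X x∉B ind =
    x∉B (max (B ∪ ⁅ x ⁆) ind (p⊆p∪q ⁅ x ⁆) (∪-lub B⊆X (⁅⁆⊆ x∈X))
             (q⊆p∪q B ⁅ x ⁆ (x∈⁅x⁆ x)))

  private
    basis-≤ : ∀ {B C} → IsBasisOf M X B → IsBasisOf M X C → ∣ C ∣ ≤ ∣ B ∣
    basis-≤ {B} {C} bB@(indB , _) (indC , C⊆X , _) = ≮⇒≥ λ B<C →
      let x , x∈C , x∉B , ind = indep-augment M indB indC B<C
      in basis-∌ bB (C⊆X x∈C) x∉B ind

  basis-card : ∀ {B C} → IsBasisOf M X B → IsBasisOf M X C → ∣ B ∣ ≡ ∣ C ∣
  basis-card bB bC = ≤-antisym (basis-≤ bC bB) (basis-≤ bB bC)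

infixl 5 _\\_ _//_

_\\_ : Matroid n → Subset n → Matroid n
(M \\ T) .ground = ground M ─ T
(M \\ T) .Indep I = I ⊆ ground M ─ T × Indep M I
(M \\ T) .indep? I = (I ⊆? (ground M ─ T)) ×-dec indep? M I
(M \\ T) .indep⊆ground (I⊆ , _) = I⊆
(M \\ T) .indep-⊥ = ⊆-min _ , indep-⊥ M
(M \\ T) .indep-⊆ I⊆J (J⊆ , ind) = (λ x∈I → J⊆ (I⊆J x∈I)) , indep-⊆ M I⊆J ind
(M \\ T) .indep-augment (I⊆ , indI) (J⊆ , indJ) I<J =
  let x , x∈J , x∉I , ind = indep-augment M indI indJ I<J
  in x , x∈J , x∉I , ∪-lub I⊆ (⁅⁆⊆ (J⊆ x∈J)) , ind

_//_ : Matroid n → Subset n → Matroid n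
(M // T) .ground = ground M ─ T
(M // T) .Indep I = I ⊆ ground M ─ T × ∃ λ B → IsBasisOf M T B × Indep M (I ∪ B)
(M // T) .indep? I =
  (I ⊆? (ground M ─ T)) ×-dec anySubset? λ B → isBasisOf? M T B ×-dec indep? M (I ∪ B)
(M // T) .indep⊆ground (I⊆ , _) = I⊆
(M // T) .indep-⊥ =
  let B , basis@(ind , _) = basis-exists M T
  in ⊆-min _ , B , basis , indep-⊆ M (∪-lub (⊆-min B) λ x∈ → x∈) ind
(M // T) .indep-⊆ {J = J} I⊆J (J⊆ , B , basis , ind) =
  (λ x∈I → J⊆ (I⊆J x∈I)) , B , basis ,
  indep-⊆ M (∪-lub (λ x∈I → p⊆p∪q B (I⊆J x∈I)) (q⊆p∪q J B)) ind
(M // T) .indep-augment {I} {J} (I⊆ , B , bB , indI) (J⊆ , C , bC , indJ) I<J =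
  x , x∈J , x∉I , ∪-lub I⊆ (⁅⁆⊆ (J⊆ x∈J)) , B , bB ,
  indep-⊆ M (∪-lub (∪-lub (λ y∈ → p⊆p∪q ⁅ x ⁆ (p⊆p∪q B y∈)) (q⊆p∪q (I ∪ B) ⁅ x ⁆))
                   (λ y∈ → p⊆p∪q ⁅ x ⁆ (q⊆p∪q I B y∈))) ind
  where
  open ≤-Reasoning
  lt : ∣ I ∪ B ∣ < ∣ J ∪ C ∣
  lt = begin-strict
    ∣ I ∪ B ∣      ≤⟨ ∣∪∣≤ I B ⟩
    ∣ I ∣ + ∣ B ∣  ≡⟨ cong (∣ I ∣ +_) (basis-card M T bB bC) ⟩
    ∣ I ∣ + ∣ C ∣  <⟨ +-monoˡ-< ∣ C ∣ I<J ⟩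
    ∣ J ∣ + ∣ C ∣  ≤⟨ ∣∪∣≥ J C (λ x∈J x∈C →
                        ∈─⇒∉ (ground M) T (J⊆ x∈J) (proj₁ (proj₂ bC) x∈C)) ⟩
    ∣ J ∪ C ∣      ∎
  aug = indep-augment M indI indJ lt
  x = proj₁ aug
  x∉I∪B = proj₁ (proj₂ (proj₂ aug))
  ind : Indep M ((I ∪ B) ∪ ⁅ x ⁆)
  ind = proj₂ (proj₂ (proj₂ aug))
  x∉I : x ∉ I
  x∉I x∈I = x∉I∪B (p⊆p∪q B x∈I)
  x∉C : x ∉ C
  x∉C x∈C = basis-∌ M T bB (proj₁ (proj₂ bC) x∈C) (λ x∈B → x∉I∪B (q⊆p∪q I B x∈B))
    (indep-⊆ M (∪-lub (λ y∈ → p⊆p∪q ⁅ x ⁆ (q⊆p∪q I B y∈)) (q⊆p∪q (I ∪ B) ⁅ x ⁆)) ind)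
  x∈J : x ∈ J
  x∈J = [ (λ x∈ → x∈) , (λ x∈C → contradiction x∈C x∉C) ]′ (x∈p∪q⁻ J C (proj₁ (proj₂ aug)))

data _⟶_ {n} (M : Matroid n) : Matroid n → Set₁ where
  delete   : ∀ T → T ⊆ ground M → M ⟶ (M \\ T)
  contract : ∀ T → T ⊆ ground M → M ⟶ (M // T)

_IsMinorOf_ : Matroid n → Matroid n → Set₁
N IsMinorOf M = Star _⟶_ M N

-- x ∈ X has at most one proof, so El X has exactly one element per member of X.
El : Subset n → Set
El X = ∃ λ x → x ∈ X

-- The last hypothesis says that J is the image of I under φ.
_≅_ : Matroid n → Matroid m → Set
M ≅ N = Σ (El (ground M) ↔ El (ground N)) λ φ →
  ∀ I J → I ⊆ ground M → J ⊆ ground N →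
  (∀ e → proj₁ e ∈ I ⇔ proj₁ (Inverse.to φ e) ∈ J) →
  Indep M I ⇔ Indep N J

U : (k m : ℕ) → k ≤ m → Matroid m
U k m k≤m .ground = ⊤
U k m k≤m .Indep I = ∣ I ∣ ≤ k
U k m k≤m .indep? I = ∣ I ∣ ≤? k
U k m k≤m .indep⊆ground _ = ⊆⊤
U k m k≤m .indep-⊥ = ≤-trans (≤-reflexive (∣⊥∣≡0 m)) z≤n
U k m k≤m .indep-⊆ I⊆J J≤k = ≤-trans (p⊆q⇒∣p∣≤∣q∣ I⊆J) J≤k
U k m k≤m .indep-augment {I} {J} I≤k J≤k I<J
  with any? (λ x → (x ∈? J) ×-dec ¬? (x ∈? I))
... | yes (x , x∈J , x∉I) = x , x∈J , x∉I , (begin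
  ∣ I ∪ ⁅ x ⁆ ∣      ≤⟨ ∣∪∣≤ I ⁅ x ⁆ ⟩
  ∣ I ∣ + ∣ ⁅ x ⁆ ∣  ≡⟨ cong (∣ I ∣ +_) (∣⁅x⁆∣≡1 x) ⟩
  ∣ I ∣ + 1          ≡⟨ +-comm ∣ I ∣ 1 ⟩
  suc ∣ I ∣          ≤⟨ I<J ⟩
  ∣ J ∣              ≤⟨ J≤k ⟩
  k                  ∎)
  where open ≤-Reasoning
... | no ∄ = contradiction I<J (≤⇒≯ (p⊆q⇒∣p∣≤∣q∣ J⊆I))
  where
  J⊆I : J ⊆ I
  J⊆I {x} x∈J = decidable-stable (x ∈? I) λ x∉I → ∄ (x , x∈J , x∉I)

IsPartialTransversal : ∀ {b} → (Fin b → Subset n) → Subset n → Set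
IsPartialTransversal {b = b} P I =
  Σ (El I → Fin b) λ f → Injective _≡_ _≡_ f × (∀ e → proj₁ e ∈ P (f e))

Presents : ∀ {b} → (Fin b → Subset n) → Matroid n → Set
Presents P M =
  (∀ i → P i ⊆ ground M) ×
  (∀ I → I ⊆ ground M → Indep M I ⇔ IsPartialTransversal P I)

IsTransversal : Matroid n → Set
IsTransversal {n} M = ∃ λ b → Σ (Fin b → Subset n) λ P → Presents P M

-- Induct on the number of indices K of a presentation, which may be taken to
-- be the rank.  If no proper nonempty set of elements meets at most as many
-- indices as it has members, the matroid is uniform by Hall's theorem, and
-- contracting |K| - 2 elements leaves a long line.  Otherwise a minimal such
-- set J, with one member h removed, matches into its index set T with any
-- prescribed index omitted.  Add to T, one at a time, any index k for which
-- some element meets T and meets the rest of K in k alone; the matching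
-- property survives.  If only one index j is left over, then contracting the
-- matched elements puts h and all elements meeting j on one line, so at most
-- ℓ elements meet j, and the rest is presented by T.  If the process stops
-- earlier, then the elements meeting only T, and the others after contracting
-- T, are two simple matroids presented by fewer indices; their bounds add up.

module Submission where

open import Defs
open import Data.Empty using (⊥-elim)
open import Data.Fin using (Fin; zero; suc; _≟_)
open import Data.Fin.Properties using (any?; all?) renaming (suc-injective to Fin-suc-injective)
open import Data.Fin.Subset
open import Data.Fin.Subset.Properties
open import Data.Nat using (ℕ; zero; suc; _+_; _*_; _∸_; _≤_; _<_; _≤?_; _<?_; z≤n; s≤s)
open import Data.Nat.Properties hiding (_≟_)
open import Data.Nat.Induction using (<-rec)
open import Data.Product using (Σ; ∃; _×_; _,_; proj₁; proj₂)
open import Data.Sum using (inj₁; inj₂; [_,_]′)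
open import Data.Vec using ([]; _∷_; here; there; tabulate)
open import Data.Vec.Properties using (lookup∘tabulate; lookup⇒[]=; []=⇒lookup)
open import Data.Vec.Properties.WithK using ([]=-irrelevant)
open import Function using (id)
open import Function.Bundles using (_⇔_; _↔_; Equivalence; mk⇔; mk↔ₛ′)
open import Relation.Binary.Construct.Closure.ReflexiveTransitive using (ε; _◅_)
open import Relation.Binary.PropositionalEquality
  using (_≡_; _≢_; refl; sym; trans; cong; subst)
open import Relation.Nullary using (¬_; Dec; does; yes; no; contradiction)
open import Relation.Nullary.Decidable
  using (_×-dec_; _→-dec_; ¬?; decidable-stable; dec-true)

-- Cardinalities of finite subsets

∣p∪⁅x⁆∣≤1+∣p∣ : ∀ {n} (p : Subset n) x → ∣ p ∪ ⁅ x ⁆ ∣ ≤ suc ∣ p ∣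
∣p∪⁅x⁆∣≤1+∣p∣ p x = begin
  ∣ p ∪ ⁅ x ⁆ ∣      ≤⟨ ∣∪∣≤ p ⁅ x ⁆ ⟩
  ∣ p ∣ + ∣ ⁅ x ⁆ ∣  ≡⟨ cong (∣ p ∣ +_) (∣⁅x⁆∣≡1 x) ⟩
  ∣ p ∣ + 1          ≡⟨ +-comm ∣ p ∣ 1 ⟩
  suc ∣ p ∣          ∎
  where open ≤-Reasoning

x∉p⇒∣p∪⁅x⁆∣≡1+∣p∣ : ∀ {n} {p : Subset n} {x} → x ∉ p → ∣ p ∪ ⁅ x ⁆ ∣ ≡ suc ∣ p ∣
x∉p⇒∣p∪⁅x⁆∣≡1+∣p∣ {p = p} {x} x∉p = ≤-antisym (∣p∪⁅x⁆∣≤1+∣p∣ p x)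
  (p⊂q⇒∣p∣<∣q∣ (p⊆p∪q ⁅ x ⁆ , x , q⊆p∪q p ⁅ x ⁆ (x∈⁅x⁆ x) , x∉p))

p⊆p─q∪q : ∀ {n} (p q : Subset n) → p ⊆ (p ─ q) ∪ q
p⊆p─q∪q p q {x} x∈p with x ∈? q
... | yes x∈q = q⊆p∪q (p ─ q) q x∈q
... | no  x∉q = p⊆p∪q q (x∈p∧x∉q⇒x∈p─q x∈p x∉q)

p⊆p-x∪⁅x⁆ : ∀ {n} (p : Subset n) x → p ⊆ (p - x) ∪ ⁅ x ⁆
p⊆p-x∪⁅x⁆ p x = p⊆p─q∪q p ⁅ x ⁆

∣p∣≤1+∣p-x∣ : ∀ {n} (p : Subset n) x → ∣ p ∣ ≤ suc ∣ p - x ∣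
∣p∣≤1+∣p-x∣ p x = ≤-trans (p⊆q⇒∣p∣≤∣q∣ (p⊆p-x∪⁅x⁆ p x)) (∣p∪⁅x⁆∣≤1+∣p∣ (p - x) x)

x∈p⇒1+∣p-x∣≡∣p∣ : ∀ {n} {p : Subset n} {x} → x ∈ p → suc ∣ p - x ∣ ≡ ∣ p ∣
x∈p⇒1+∣p-x∣≡∣p∣ {p = p} {x} x∈p = ≤-antisym (x∈p⇒∣p-x∣<∣p∣ x∈p) (∣p∣≤1+∣p-x∣ p x)

∣p∣≤∣p─q∣+∣q∣ : ∀ {n} (p q : Subset n) → ∣ p ∣ ≤ ∣ p ─ q ∣ + ∣ q ∣
∣p∣≤∣p─q∣+∣q∣ p q = ≤-trans (p⊆q⇒∣p∣≤∣q∣ (p⊆p─q∪q p q)) (∣∪∣≤ (p ─ q) q)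

q⊆p⇒∣p─q∣+∣q∣≡∣p∣ : ∀ {n} {p q : Subset n} → q ⊆ p → ∣ p ─ q ∣ + ∣ q ∣ ≡ ∣ p ∣
q⊆p⇒∣p─q∣+∣q∣≡∣p∣ {p = p} {q} q⊆p = ≤-antisym
  (≤-trans (∣∪∣≥ (p ─ q) q (∈─⇒∉ p q)) (p⊆q⇒∣p∣≤∣q∣ (∪-lub (p─q⊆p p q) q⊆p)))
  (∣p∣≤∣p─q∣+∣q∣ p q)

x∉p-x : ∀ {n} (p : Subset n) x → x ∉ p - x
x∉p-x p x x∈ = ∈─⇒∉ p ⁅ x ⁆ x∈ (x∈⁅x⁆ x)

p-x⊆p : ∀ {n} (p : Subset n) x → p - x ⊆ p
p-x⊆p p x = p─q⊆p p ⁅ x ⁆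

x∈p-y⇒x≢y : ∀ {n} (p : Subset n) y {x} → x ∈ p - y → x ≢ y
x∈p-y⇒x≢y p y x∈ refl = x∉p-x p y x∈

0<∣p∣⇒Nonempty : ∀ {n} (p : Subset n) → 0 < ∣ p ∣ → Nonempty p
0<∣p∣⇒Nonempty {n} p 0<p with nonempty? p
... | yes ne = ne
... | no  e  = contradiction 0<p
  (≤⇒≯ (≤-reflexive (trans (cong ∣_∣ (Empty-unique e)) (∣⊥∣≡0 n))))

x∈p⇒0<∣p∣ : ∀ {n} {p : Subset n} {x} → x ∈ p → 0 < ∣ p ∣
x∈p⇒0<∣p∣ x∈p = ≤-trans (s≤s z≤n) (x∈p⇒∣p-x∣<∣p∣ x∈p)

∣p∣≡0⇒∉ : ∀ {n} {p : Subset n} → ∣ p ∣ ≤ 0 → ∀ {x} → x ∉ p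
∣p∣≡0⇒∉ p≤0 x∈p = contradiction (x∈p⇒0<∣p∣ x∈p) (≤⇒≯ p≤0)

select : ∀ {n} {P : Fin n → Set} → (∀ x → Dec (P x)) → Subset n
select P? = tabulate λ x → does (P? x)

∈-select⁺ : ∀ {n} {P : Fin n → Set} (P? : ∀ x → Dec (P x)) {x} → P x → x ∈ select P?
∈-select⁺ P? {x} px =
  lookup⇒[]= x (select P?) (trans (lookup∘tabulate _ x) (dec-true (P? x) px))

∈-select⁻ : ∀ {n} {P : Fin n → Set} (P? : ∀ x → Dec (P x)) {x} → x ∈ select P? → P x
∈-select⁻ P? {x} x∈ with P? x | trans (sym (lookup∘tabulate (λ y → does (P? y)) x)) ([]=⇒lookup x∈)
... | yes px | _  = px
... | no  _  | ()

-- The head of `p` uses up one image `y`, and injectivity keeps the images of the tail inside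
-- `q - y`. A relation in place of a function lets the image depend on a membership proof, or be any
-- of several candidates.
injection⇒∣p∣≤∣q∣ : ∀ {n m} {R : Fin n → Fin m → Set} (p : Subset n) (q : Subset m) →
  (∀ {x} → x ∈ p → ∃ λ y → y ∈ q × R x y) →
  (∀ {x x′ y} → x ∈ p → x′ ∈ p → R x y → R x′ y → x ≡ x′) → ∣ p ∣ ≤ ∣ q ∣
injection⇒∣p∣≤∣q∣ []            q tot inj = z≤n
injection⇒∣p∣≤∣q∣ (outside ∷ p) q tot inj = injection⇒∣p∣≤∣q∣ p q (λ x∈ → tot (there x∈))
  λ x∈ x′∈ r r′ → Fin-suc-injective (inj (there x∈) (there x′∈) r r′)
injection⇒∣p∣≤∣q∣ {R = R} (inside ∷ p) q tot inj with tot here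
... | y , y∈q , r₀ = ≤-trans (s≤s (injection⇒∣p∣≤∣q∣ p (q - y) tot′
    λ x∈ x′∈ r r′ → Fin-suc-injective (inj (there x∈) (there x′∈) r r′)))
  (≤-reflexive (x∈p⇒1+∣p-x∣≡∣p∣ y∈q))
  where
  tot′ : ∀ {x} → x ∈ p → ∃ λ z → z ∈ q - y × R (suc x) z
  tot′ {x} x∈ with tot (there x∈)
  ... | z , z∈q , r = z , x∈p∧x≢y⇒x∈p-y z∈q z≢y , r
    where
    z≢y : z ≢ y
    z≢y refl with () ← inj here (there x∈) r₀ r

∣p∣≤1⇒unique : ∀ {n} {p : Subset n} {x y} → ∣ p ∣ ≤ 1 → x ∈ p → y ∈ p → x ≡ y
∣p∣≤1⇒unique {p = p} {x} {y} p≤1 x∈p y∈p = decidable-stable (x ≟ y) λ x≢y →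
  ∣p∣≡0⇒∉ (≤-pred (<-≤-trans (x∈p⇒∣p-x∣<∣p∣ y∈p) p≤1)) (x∈p∧x≢y⇒x∈p-y x∈p x≢y)

subset-of-size : ∀ {n} (p : Subset n) m → m ≤ ∣ p ∣ → ∃ λ q → q ⊆ p × ∣ q ∣ ≡ m
subset-of-size []            zero    _   = [] , id , refl
subset-of-size (outside ∷ p) m       m≤  =
  let q , q⊆p , ∣q∣≡m = subset-of-size p m m≤ in outside ∷ q , s⊆s q⊆p , ∣q∣≡m
subset-of-size {n} (inside ∷ p) zero m≤  = ⊥ , ⊆-min _ , ∣⊥∣≡0 n
subset-of-size (inside ∷ p) (suc m) (s≤s m≤) =
  let q , q⊆p , ∣q∣≡m = subset-of-size p m m≤ in inside ∷ q , s⊆s q⊆p , cong suc ∣q∣≡m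

superset-of-size : ∀ {n} {p r : Subset n} m → p ⊆ r → ∣ p ∣ ≤ m → m ≤ ∣ r ∣ →
  ∃ λ q → p ⊆ q × q ⊆ r × ∣ q ∣ ≡ m
superset-of-size {p = p} {r} m p⊆r p≤m m≤r
  with subset-of-size (r ─ p) (m ∸ ∣ p ∣) (≤-trans (∸-monoˡ-≤ ∣ p ∣ m≤r) (≤-reflexive r∸p))
  where
  r∸p : ∣ r ∣ ∸ ∣ p ∣ ≡ ∣ r ─ p ∣
  r∸p = trans (cong (_∸ ∣ p ∣) (sym (q⊆p⇒∣p─q∣+∣q∣≡∣p∣ p⊆r))) (m+n∸n≡m ∣ r ─ p ∣ ∣ p ∣)
... | s , s⊆ , ∣s∣≡ = p ∪ s , p⊆p∪q s , ∪-lub p⊆r (λ x∈ → p─q⊆p r p (s⊆ x∈)) ,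
  trans (≤-antisym (∣∪∣≤ p s) (∣∪∣≥ p s λ x∈p x∈s → ∈─⇒∉ r p (s⊆ x∈s) x∈p))
        (trans (cong (∣ p ∣ +_) ∣s∣≡) (m+[n∸m]≡n p≤m))

∣p∣≡2⇒pair : ∀ {n} (p : Subset n) → ∣ p ∣ ≡ 2 →
  ∃ λ x → ∃ λ y → x ≢ y × x ∈ p × y ∈ p × p ⊆ ⁅ x ⁆ ∪ ⁅ y ⁆
∣p∣≡2⇒pair p ∣p∣≡2
  with 0<∣p∣⇒Nonempty p (≤-trans (s≤s z≤n) (≤-reflexive (sym ∣p∣≡2)))
... | x , x∈p
  with 0<∣p∣⇒Nonempty (p - x) (≤-reflexive (suc-injective (trans (sym ∣p∣≡2) (sym (x∈p⇒1+∣p-x∣≡∣p∣ x∈p)))))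
... | y , y∈p-x = x , y , (λ x≡y → x∈p-y⇒x≢y p x y∈p-x (sym x≡y)) , x∈p , p-x⊆p p x y∈p-x , covered
  where
  p-x-y≤0 : ∣ p - x - y ∣ ≤ 0
  p-x-y≤0 = ≤-pred (≤-trans (x∈p⇒∣p-x∣<∣p∣ y∈p-x)
    (≤-pred (≤-trans (x∈p⇒∣p-x∣<∣p∣ x∈p) (≤-reflexive ∣p∣≡2))))
  covered : p ⊆ ⁅ x ⁆ ∪ ⁅ y ⁆
  covered {z} z∈p with z ≟ x | z ≟ y
  ... | yes refl | _        = p⊆p∪q ⁅ y ⁆ (x∈⁅x⁆ x)
  ... | no  _    | yes refl = q⊆p∪q ⁅ x ⁆ ⁅ y ⁆ (x∈⁅x⁆ y)
  ... | no  z≢x  | no  z≢y  = contradiction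
    (x∈p∧x≢y⇒x∈p-y (x∈p∧x≢y⇒x∈p-y z∈p z≢x) z≢y) (∣p∣≡0⇒∉ p-x-y≤0)

minimal-subset : ∀ {n} {P : Subset n → Set} → (∀ J → Dec (P J)) → ∃ P →
  ∃ λ J → P J × (∀ L → P L → ∣ J ∣ ≤ ∣ L ∣)
minimal-subset {P = P} P? (J , PJ) = search ∣ J ∣ J PJ ≤-refl
  where
  search : ∀ m J → P J → ∣ J ∣ ≤ m → ∃ λ J → P J × (∀ L → P L → ∣ J ∣ ≤ ∣ L ∣)
  search m J PJ J≤m with anySubset? (λ L → P? L ×-dec (∣ L ∣ <? ∣ J ∣))
  ... | no ∄ = J , PJ , λ L PL → ≮⇒≥ λ L<J → ∄ (L , PL , L<J)
  search zero    J PJ J≤m | yes (L , PL , L<J) = contradiction (<-≤-trans L<J J≤m) λ ()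
  search (suc m) J PJ J≤m | yes (L , PL , L<J) = search m L PL (≤-pred (<-≤-trans L<J J≤m))

-- Matchings of elements into a set of indices

module Matchings {n b : ℕ} (S : Fin n → Subset b) (k₀ : Fin b) where

  -- The values of assign outside I are irrelevant.
  record Match (I : Subset n) (K : Subset b) : Set where
    field
      assign     : Fin n → Fin b
      assign∈K   : ∀ {x} → x ∈ I → assign x ∈ K
      assign∈S   : ∀ {x} → x ∈ I → assign x ∈ S x
      assign-inj : ∀ {x y} → x ∈ I → y ∈ I → assign x ≡ assign y → x ≡ y
  open Match public

  match-size : ∀ {I K} → Match I K → ∣ I ∣ ≤ ∣ K ∣
  match-size {I} {K} f = injection⇒∣p∣≤∣q∣ {R = λ x k → assign f x ≡ k} I K
    (λ x∈ → assign f _ , assign∈K f x∈ , refl)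
    (λ x∈ y∈ fx≡k fy≡k → assign-inj f x∈ y∈ (trans fx≡k (sym fy≡k)))

  match-⊆ : ∀ {I J K} → I ⊆ J → Match J K → Match I K
  match-⊆ I⊆J f .assign = assign f
  match-⊆ I⊆J f .assign∈K x∈ = assign∈K f (I⊆J x∈)
  match-⊆ I⊆J f .assign∈S x∈ = assign∈S f (I⊆J x∈)
  match-⊆ I⊆J f .assign-inj x∈ y∈ = assign-inj f (I⊆J x∈) (I⊆J y∈)

  match-into : ∀ {I K L} → (∀ {x k} → x ∈ I → k ∈ K → k ∈ S x → k ∈ L) →
    Match I K → Match I L
  match-into into f .assign = assign f
  match-into into f .assign∈K x∈ = into x∈ (assign∈K f x∈) (assign∈S f x∈)
  match-into into f .assign∈S = assign∈S f
  match-into into f .assign-inj = assign-inj f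

  match-widen : ∀ {I K L} → K ⊆ L → Match I K → Match I L
  match-widen K⊆L = match-into λ _ k∈K _ → K⊆L k∈K

  match-avoid : ∀ {I K k} (f : Match I K) → (∀ {x} → x ∈ I → assign f x ≢ k) →
    Match I (K - k)
  match-avoid f f≢k .assign = assign f
  match-avoid f f≢k .assign∈K x∈ = x∈p∧x≢y⇒x∈p-y (assign∈K f x∈) (f≢k x∈)
  match-avoid f f≢k .assign∈S = assign∈S f
  match-avoid f f≢k .assign-inj = assign-inj f

  match-empty : ∀ {I K} → (∀ {x} → x ∉ I) → Match I K
  -- A total function needs a value even when there is nothing to match; `k₀` is that default.
  match-empty empty .assign _ = k₀
  match-empty empty .assign∈K x∈ = contradiction x∈ empty
  match-empty empty .assign∈S x∈ = contradiction x∈ empty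
  match-empty empty .assign-inj x∈ = contradiction x∈ empty

  match-⁅⁆ : ∀ {x k} → k ∈ S x → Match ⁅ x ⁆ ⁅ k ⁆
  match-⁅⁆ {x} {k} k∈ .assign _ = k
  match-⁅⁆ {x} {k} k∈ .assign∈K _ = x∈⁅x⁆ k
  match-⁅⁆ {x} {k} k∈ .assign∈S y∈ = subst (λ y → k ∈ S y) (sym (x∈⁅y⁆⇒x≡y x y∈)) k∈
  match-⁅⁆ {x} {k} k∈ .assign-inj y∈ z∈ _ = trans (x∈⁅y⁆⇒x≡y x y∈) (sym (x∈⁅y⁆⇒x≡y x z∈))

  module _ {I J : Subset n} {K L : Subset b} (K∌L : ∀ {k} → k ∈ K → k ∉ L)
           (f : Match I K) (g : Match J L) where

    private
      glue : Fin n → Fin b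
      glue x with x ∈? I
      ... | yes _ = assign f x
      ... | no  _ = assign g x

      x∈J : ∀ {x} → x ∈ I ∪ J → x ∉ I → x ∈ J
      x∈J x∈ x∉I = [ (λ x∈I → contradiction x∈I x∉I) , id ]′ (x∈p∪q⁻ I J x∈)

    -- `I` and `J` may overlap; there `f` takes precedence. A value of `f` cannot clash with one of
    -- `g` because `K` and `L` are disjoint.
    match-∪ : Match (I ∪ J) (K ∪ L)
    match-∪ .assign = glue
    match-∪ .assign∈K {x} x∈ with x ∈? I
    ... | yes x∈I = p⊆p∪q L (assign∈K f x∈I)
    ... | no  x∉I = q⊆p∪q K L (assign∈K g (x∈J x∈ x∉I))
    match-∪ .assign∈S {x} x∈ with x ∈? I
    ... | yes x∈I = assign∈S f x∈I
    ... | no  x∉I = assign∈S g (x∈J x∈ x∉I)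
    match-∪ .assign-inj {x} {y} x∈ y∈ eq with x ∈? I | y ∈? I
    ... | yes x∈I | yes y∈I = assign-inj f x∈I y∈I eq
    ... | yes x∈I | no  y∉I = contradiction (assign∈K g (x∈J y∈ y∉I))
      (K∌L (subst (_∈ K) eq (assign∈K f x∈I)))
    ... | no  x∉I | yes y∈I = contradiction (assign∈K g (x∈J x∈ x∉I))
      (K∌L (subst (_∈ K) (sym eq) (assign∈K f y∈I)))
    ... | no  x∉I | no  y∉I = assign-inj g (x∈J x∈ x∉I) (x∈J y∈ y∉I) eq

  match-insert : ∀ {I K x k} → Match I (K - k) → k ∈ K → k ∈ S x → Match (I ∪ ⁅ x ⁆) K
  match-insert {K = K} {k = k} f k∈K k∈S = match-widen (∪-lub (p-x⊆p K k) (⁅⁆⊆ k∈K))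
    (match-∪ (∈─⇒∉ K ⁅ k ⁆) f (match-⁅⁆ k∈S))

  -- Hall's theorem

  private
    adjacent? : ∀ I K k → Dec (k ∈ K × ∃ λ x → x ∈ I × k ∈ S x)
    adjacent? I K k = (k ∈? K) ×-dec any? λ x → (x ∈? I) ×-dec (k ∈? S x)

  neighbours : Subset n → Subset b → Subset b
  neighbours I K = select (adjacent? I K)

  ∈-neighbours⁺ : ∀ {I K x k} → x ∈ I → k ∈ K → k ∈ S x → k ∈ neighbours I K
  ∈-neighbours⁺ {I} {K} x∈I k∈K k∈S = ∈-select⁺ (adjacent? I K) (k∈K , _ , x∈I , k∈S)

  ∈-neighbours⁻ : ∀ I K {k} → k ∈ neighbours I K → k ∈ K × ∃ λ x → x ∈ I × k ∈ S x
  ∈-neighbours⁻ I K = ∈-select⁻ (adjacent? I K)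

  neighbours-⊆ : ∀ {I J K} → I ⊆ J → neighbours I K ⊆ neighbours J K
  neighbours-⊆ {I} {J} {K} I⊆J k∈ =
    let k∈K , x , x∈I , k∈S = ∈-neighbours⁻ I K k∈ in ∈-neighbours⁺ (I⊆J x∈I) k∈K k∈S

  neighbours-─ : ∀ I K L → neighbours I K ⊆ neighbours I (K ─ L) ∪ L
  neighbours-─ I K L {k} k∈ with k ∈? L | ∈-neighbours⁻ I K k∈
  ... | yes k∈L | _ = q⊆p∪q (neighbours I (K ─ L)) L k∈L
  ... | no  k∉L | k∈K , x , x∈I , k∈S =
    p⊆p∪q L (∈-neighbours⁺ x∈I (x∈p∧x∉q⇒x∈p─q k∈K k∉L) k∈S)

  Hall : Subset n → Subset b → Set
  Hall I K = ∀ {J} → J ⊆ I → ∣ J ∣ ≤ ∣ neighbours J K ∣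

  -- Losing one index costs a set at most one neighbour, which a strict surplus can afford.
  hall-delete : ∀ {I K k} →
    (∀ {J} → J ⊆ I → Nonempty J → ∣ J ∣ < ∣ neighbours J K ∣) → Hall I (K - k)
  hall-delete {I} {K} {k} surplus {J} J⊆I with ∣ J ∣ ≤? 0
  ... | yes J≤0 = ≤-trans J≤0 z≤n
  ... | no  J≰0 = ≤-pred (begin
    suc ∣ J ∣                              ≤⟨ surplus J⊆I (0<∣p∣⇒Nonempty J (≰⇒> J≰0)) ⟩
    ∣ neighbours J K ∣                     ≤⟨ p⊆q⇒∣p∣≤∣q∣ (neighbours-─ J K ⁅ k ⁆) ⟩
    ∣ neighbours J (K - k) ∪ ⁅ k ⁆ ∣       ≤⟨ ∣p∪⁅x⁆∣≤1+∣p∣ (neighbours J (K - k)) k ⟩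
    suc ∣ neighbours J (K - k) ∣           ∎)
    where open ≤-Reasoning

  -- Drop one element `x` from `J`: the surplus of `J - x`, which has fewer than `m` elements,
  -- already provides `∣ J ∣` neighbours. So surplus below size `m` yields Hall's condition up to
  -- size `m`. Singletons, for which `J - x` is empty, rely on `trace`.
  surplus⇒hall : ∀ {m Y K} → (∀ {x} → x ∈ Y → ∃ λ k → k ∈ K × k ∈ S x) →
    (∀ {J} → J ⊆ Y → Nonempty J → ∣ J ∣ < m → ∣ J ∣ < ∣ neighbours J K ∣) →
    ∀ {I} → I ⊆ Y → ∣ I ∣ ≤ m → Hall I K
  surplus⇒hall {m} {Y} {K} trace surplus I⊆Y I≤m {J} J⊆I with nonempty? J
  ... | no  e = ≤-trans (≮⇒≥ λ 0<J → e (0<∣p∣⇒Nonempty J 0<J)) z≤n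
  ... | yes (x , x∈J) with nonempty? (J - x)
  ... | no  e = ≤-trans (∣p∣≤1+∣p-x∣ J x) (≤-trans
    (s≤s (≮⇒≥ λ 0<J-x → e (0<∣p∣⇒Nonempty (J - x) 0<J-x)))
    (let k , k∈K , k∈S = trace (I⊆Y (J⊆I x∈J)) in x∈p⇒0<∣p∣ (∈-neighbours⁺ x∈J k∈K k∈S)))
  ... | yes ne = begin
    ∣ J ∣                     ≤⟨ ∣p∣≤1+∣p-x∣ J x ⟩
    suc ∣ J - x ∣             ≤⟨ surplus (λ y∈ → I⊆Y (J⊆I (p-x⊆p J x y∈))) ne
                                   (<-≤-trans (x∈p⇒∣p-x∣<∣p∣ x∈J) (≤-trans (p⊆q⇒∣p∣≤∣q∣ J⊆I) I≤m)) ⟩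
    ∣ neighbours (J - x) K ∣  ≤⟨ p⊆q⇒∣p∣≤∣q∣ (neighbours-⊆ (p-x⊆p J x)) ⟩
    ∣ neighbours J K ∣        ∎
    where open ≤-Reasoning

  private
    IsTight : ℕ → Subset n → Subset b → Subset n → Set
    IsTight m I K J = J ⊆ I × Nonempty J × ∣ J ∣ < m × ∣ neighbours J K ∣ ≤ ∣ J ∣

    isTight? : ∀ m I K J → Dec (IsTight m I K J)
    isTight? m I K J =
      (J ⊆? I) ×-dec nonempty? J ×-dec (∣ J ∣ <? m) ×-dec (∣ neighbours J K ∣ ≤? ∣ J ∣)

    -- Apply Hall's condition to `L ∪ J`: at most `∣ J ∣` of its neighbours lie in those of `J`, and
    -- all others are neighbours of `L`.
    hall-─ : ∀ {I K J} → Hall I K → J ⊆ I → ∣ neighbours J K ∣ ≤ ∣ J ∣ →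
      Hall (I ─ J) (K ─ neighbours J K)
    hall-─ {I} {K} {J} hall J⊆I tight {L} L⊆ = +-cancelʳ-≤ (∣ J ∣) _ _ (begin
      ∣ L ∣ + ∣ J ∣                                ≤⟨ ∣∪∣≥ L J (λ x∈L → ∈─⇒∉ I J (L⊆ x∈L)) ⟩
      ∣ L ∪ J ∣                                    ≤⟨ hall (∪-lub (λ x∈ → p─q⊆p I J (L⊆ x∈)) J⊆I) ⟩
      ∣ neighbours (L ∪ J) K ∣                     ≤⟨ p⊆q⇒∣p∣≤∣q∣ split ⟩
      ∣ neighbours L (K ─ NJ) ∪ NJ ∣               ≤⟨ ∣∪∣≤ (neighbours L (K ─ NJ)) NJ ⟩
      ∣ neighbours L (K ─ NJ) ∣ + ∣ NJ ∣           ≤⟨ +-monoʳ-≤ ∣ neighbours L (K ─ NJ) ∣ tight ⟩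
      ∣ neighbours L (K ─ NJ) ∣ + ∣ J ∣            ∎)
      where
      open ≤-Reasoning
      NJ = neighbours J K
      split : neighbours (L ∪ J) K ⊆ neighbours L (K ─ NJ) ∪ NJ
      split k∈ with ∈-neighbours⁻ (L ∪ J) K k∈
      ... | k∈K , x , x∈ , k∈S with x∈p∪q⁻ L J x∈
      ... | inj₁ x∈L = neighbours-─ L K NJ (∈-neighbours⁺ x∈L k∈K k∈S)
      ... | inj₂ x∈J = q⊆p∪q (neighbours L (K ─ NJ)) NJ (∈-neighbours⁺ x∈J k∈K k∈S)

    -- Induction on a bound `m` for `∣ I ∣`. A tight proper subset `J` and the rest of `I` are
    -- matched separately, into `NJ` and into its complement in `K`. If there is none, every
    -- nonempty proper subset has surplus, so any element may take any of its neighbours.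
    hall-bounded : ∀ m {I K} → ∣ I ∣ ≤ m → Hall I K → Match I K
    hall-bounded zero    I≤m hall = match-empty (∣p∣≡0⇒∉ I≤m)
    hall-bounded (suc m) {I} {K} I≤m hall with anySubset? (isTight? ∣ I ∣ I K)
    ... | yes (J , J⊆I , (x , x∈J) , J<I , tight) = match-⊆ I⊆
      (match-widen (∪-lub NJ⊆K (p─q⊆p K NJ))
        (match-∪ (λ k∈ k∈─ → ∈─⇒∉ K NJ k∈─ k∈)
          (match-into ∈-neighbours⁺ (hall-bounded m (≤-pred (<-≤-trans J<I I≤m))
            λ L⊆J → hall (λ x∈ → J⊆I (L⊆J x∈))))
          (hall-bounded m (≤-pred (<-≤-trans
            (p∩q≢∅⇒∣p─q∣<∣p∣ I J (x , x∈p∩q⁺ (J⊆I x∈J , x∈J))) I≤m)) (hall-─ hall J⊆I tight))))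
      where
      NJ = neighbours J K
      NJ⊆K : NJ ⊆ K
      NJ⊆K k∈ = proj₁ (∈-neighbours⁻ J K k∈)
      I⊆ : I ⊆ J ∪ (I ─ J)
      I⊆ x∈ = [ q⊆p∪q J (I ─ J) , p⊆p∪q (I ─ J) ]′ (x∈p∪q⁻ (I ─ J) J (p⊆p─q∪q I J x∈))
    ... | no ∄ with nonempty? I
    ... | no  e = match-empty λ x∈ → e (_ , x∈)
    ... | yes (x , x∈I) with 0<∣p∣⇒Nonempty (neighbours ⁅ x ⁆ K)
                               (≤-trans (≤-reflexive (sym (∣⁅x⁆∣≡1 x))) (hall (⁅⁆⊆ x∈I)))
    ... | k , k∈ with ∈-neighbours⁻ ⁅ x ⁆ K k∈
    ... | k∈K , y , y∈ , k∈S with x∈⁅y⁆⇒x≡y x y∈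
    ... | refl = match-⊆ (p⊆p-x∪⁅x⁆ I x) (match-insert
      (hall-bounded m (≤-pred (<-≤-trans (x∈p⇒∣p-x∣<∣p∣ x∈I) I≤m))
        (hall-delete λ J⊆ ne → ≰⇒> λ tight → ∄ (_ , (λ x∈ → p-x⊆p I x (J⊆ x∈)) , ne ,
          ≤-<-trans (p⊆q⇒∣p∣≤∣q∣ J⊆) (x∈p⇒∣p-x∣<∣p∣ x∈I) , tight)))
      k∈K k∈S)

  hall⇒match : ∀ {I K} → Hall I K → Match I K
  hall⇒match {I} = hall-bounded ∣ I ∣ ≤-refl

  -- Reduction to as many indices as the rank

  match-avoid-unused : ∀ m {Y K B I k} (g : Match B K) → k ∈ K →
    (∀ {x} → x ∈ B → assign g x ≢ k) → B ⊆ Y →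
    (∀ {J} → J ⊆ Y → Match J K → ∣ J ∣ ≤ ∣ B ∣) →
    I ⊆ Y → ∣ I ∣ ≤ m → Match I K → Match I (K - k)
  match-avoid-unused zero g k∈K unused B⊆Y max I⊆Y I≤m f = match-empty (∣p∣≡0⇒∉ I≤m)
  match-avoid-unused (suc m) {Y} {K} {B} {I} {k} g k∈K unused B⊆Y max I⊆Y I≤m f
    with any? (λ x → (x ∈? I) ×-dec (assign f x ≟ k))
  ... | no  ∄ = match-avoid f λ x∈ fx≡k → ∄ (_ , x∈ , fx≡k)
  ... | yes (y , y∈I , refl) with y ∈? B
  ... | no  y∉B = contradiction
    (max (∪-lub B⊆Y (⁅⁆⊆ (I⊆Y y∈I))) (match-insert (match-avoid g unused) k∈K (assign∈S f y∈I)))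
    (<⇒≱ (≤-reflexive (sym (x∉p⇒∣p∪⁅x⁆∣≡1+∣p∣ y∉B))))
  ... | yes y∈B = match-⊆ (p⊆p-x∪⁅x⁆ I y) (match-insert
    (match-avoid-unused m {Y - y} {K - k}
      (match-⊆ (p-x⊆p B y) (match-avoid g unused))
      k₁∈ (λ x∈ gx≡k₁ → x∈p-y⇒x≢y B y x∈ (assign-inj g (p-x⊆p B y x∈) y∈B gx≡k₁))
      (λ x∈ → x∈p∧x≢y⇒x∈p-y (B⊆Y (p-x⊆p B y x∈)) (x∈p-y⇒x≢y B y x∈))
      max′
      (λ x∈ → x∈p∧x≢y⇒x∈p-y (I⊆Y (p-x⊆p I y x∈)) (x∈p-y⇒x≢y I y x∈))
      (≤-pred (<-≤-trans (x∈p⇒∣p-x∣<∣p∣ y∈I) I≤m))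
      (match-avoid (match-⊆ (p-x⊆p I y) f) λ x∈ fx≡k →
        x∈p-y⇒x≢y I y x∈ (assign-inj f (p-x⊆p I y x∈) y∈I fx≡k)))
    k₁∈ (assign∈S g y∈B))
    where
    k₁∈ : assign g y ∈ K - k
    k₁∈ = x∈p∧x≢y⇒x∈p-y (assign∈K g y∈B) (unused y∈B)
    -- A matching that avoids `y` and `k` extends by `y` at `k`, so `B - y` is again maximum.
    max′ : ∀ {J} → J ⊆ Y - y → Match J (K - k) → ∣ J ∣ ≤ ∣ B - y ∣
    max′ {J} J⊆ h = ≤-pred (begin
      suc ∣ J ∣      ≡⟨ x∉p⇒∣p∪⁅x⁆∣≡1+∣p∣ (λ y∈J → x∉p-x Y y (J⊆ y∈J)) ⟨
      ∣ J ∪ ⁅ y ⁆ ∣  ≤⟨ max (∪-lub (λ x∈ → p-x⊆p Y y (J⊆ x∈)) (⁅⁆⊆ (I⊆Y y∈I)))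
                          (match-insert h k∈K (assign∈S f y∈I)) ⟩
      ∣ B ∣          ≡⟨ x∈p⇒1+∣p-x∣≡∣p∣ y∈B ⟨
      suc ∣ B - y ∣  ∎)
      where open ≤-Reasoning

  maximum-match-suffices : ∀ d {K B} → Match B K → (∀ {J} → Match J K → ∣ J ∣ ≤ ∣ B ∣) →
    ∣ K ∣ ≡ d + ∣ B ∣ → ∃ λ L → ∣ L ∣ ≡ ∣ B ∣ × (∀ {I} → Match I K → Match I L)
  maximum-match-suffices zero {K} g max K≡B = K , K≡B , id
  maximum-match-suffices (suc d) {K} {B} g max K≡
    with any? (λ k → (k ∈? K) ×-dec ¬? (any? λ x → (x ∈? B) ×-dec (assign g x ≟ k)))
  ... | no ∄ = contradiction
    (injection⇒∣p∣≤∣q∣ {R = λ k x → assign g x ≡ k} K B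
      (λ {k} k∈K → decidable-stable (any? λ x → (x ∈? B) ×-dec (assign g x ≟ k))
        λ unused → ∄ (k , k∈K , unused))
      (λ _ _ gx≡k gx≡k′ → trans (sym gx≡k) gx≡k′))
    (<⇒≱ (≤-trans (s≤s (m≤n+m ∣ B ∣ d)) (≤-reflexive (sym K≡))))
  ... | yes (k , k∈K , unused)
    with maximum-match-suffices d {K - k} {B} (match-avoid g λ x∈ gx≡k → unused (_ , x∈ , gx≡k))
           (λ f → max (match-widen (p-x⊆p K k) f))
           (suc-injective (trans (x∈p⇒1+∣p-x∣≡∣p∣ k∈K) K≡))
  ... | L , L≡ , suffices = L , L≡ , λ {I} f →
    suffices (match-avoid-unused ∣ I ∣ {⊤} g k∈K (λ x∈ gx≡k → unused (_ , x∈ , gx≡k))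
      (⊆-max B) (λ _ → max) (⊆-max I) ≤-refl f)

  -- The size bound

  -- Simplicity of the matroid on `X` presented by the indices in `K`: `trace` excludes loops, and
  -- two nonloops are parallel exactly when both meet `K` in the same index and no other.
  record SimpleOn (K : Subset b) (X : Subset n) : Set where
    field
      trace : ∀ {x} → x ∈ X → ∃ λ k → k ∈ K × k ∈ S x
      apart : ∀ {x y k} → x ∈ X → y ∈ X → x ≢ y →
        (∀ {j} → j ∈ K → j ∈ S x → j ≡ k) → ¬ (∀ {j} → j ∈ K → j ∈ S y → j ≡ k)
  open SimpleOn

  -- The hypotheses on F and C say that contracting F and restricting to C gives
  -- a uniform matroid of rank two.
  NoLongLine : ℕ → Subset b → Subset n → Set
  NoLongLine ℓ K X = ∀ {F C} → F ⊆ X → C ⊆ X → (∀ {x} → x ∈ C → x ∉ F) →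
    (∀ {x y} → x ∈ C → y ∈ C → x ≢ y → Match (F ∪ (⁅ x ⁆ ∪ ⁅ y ⁆)) K) →
    (∀ {J} → J ⊆ C → Match (F ∪ J) K → ∣ J ∣ ≤ 2) → ∣ C ∣ ≤ suc ℓ

  -- Restriction and contraction along a set of indices

  SupportedOn : Subset b → Subset b → Subset n → Set
  SupportedOn K T Y = ∀ {x k} → x ∈ Y → k ∈ K → k ∈ S x → k ∈ T

  SimpleOn-restrict : ∀ {K T X Y} → T ⊆ K → Y ⊆ X → SupportedOn K T Y →
    SimpleOn K X → SimpleOn T Y
  SimpleOn-restrict T⊆K Y⊆X supp simple .trace x∈ =
    let k , k∈K , k∈S = trace simple (Y⊆X x∈) in k , supp x∈ k∈K k∈S , k∈S
  SimpleOn-restrict T⊆K Y⊆X supp simple .apart x∈ y∈ x≢y x-only y-only =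
    apart simple (Y⊆X x∈) (Y⊆X y∈) x≢y
      (λ j∈K j∈S → x-only (supp x∈ j∈K j∈S) j∈S)
      (λ j∈K j∈S → y-only (supp y∈ j∈K j∈S) j∈S)

  -- Elements supported on `T` have the same matchings into `K` as into `T`, so a line in the
  -- restriction is a line in the whole.
  NoLongLine-restrict : ∀ {ℓ K T X Y} → T ⊆ K → Y ⊆ X → SupportedOn K T Y →
    NoLongLine ℓ K X → NoLongLine ℓ T Y
  NoLongLine-restrict T⊆K Y⊆X supp short {F} {C} F⊆ C⊆ dis pairs rank≤2 =
    short (λ x∈ → Y⊆X (F⊆ x∈)) (λ x∈ → Y⊆X (C⊆ x∈)) dis
      (λ x∈ y∈ x≢y → match-widen T⊆K (pairs x∈ y∈ x≢y))
      (λ J⊆C f → rank≤2 J⊆C (match-into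
        (λ x∈ → supp (∪-lub F⊆ (λ y∈ → C⊆ (J⊆C y∈)) x∈)) f))

  -- `W` is matched into `T` and is large enough to fill it, so contracting `W` erases the indices
  -- in `T`. A line over `K ─ T` obtained by contracting `F` is thus a line over `K` obtained by
  -- contracting `F ∪ W`.
  NoLongLine-contract : ∀ {ℓ K T X Y W} → T ⊆ K → Y ⊆ X → W ⊆ X →
    (∀ {x} → x ∈ Y → x ∉ W) → SupportedOn K T W → Match W T → ∣ T ∣ ≤ ∣ W ∣ →
    NoLongLine ℓ K X → NoLongLine ℓ (K ─ T) Y
  NoLongLine-contract {ℓ} {K} {T} {X} {Y} {W} T⊆K Y⊆X W⊆X Y∌W supp g T≤W short
    {F} {C} F⊆ C⊆ dis pairs rank≤2 =
    short {F ∪ W} {C} (∪-lub (λ x∈ → Y⊆X (F⊆ x∈)) W⊆X) (λ x∈ → Y⊆X (C⊆ x∈))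
      (λ x∈C x∈ → [ dis x∈C , Y∌W (C⊆ x∈C) ]′ (x∈p∪q⁻ F W x∈))
      (λ {x} {y} x∈ y∈ x≢y →
        let P = ⁅ x ⁆ ∪ ⁅ y ⁆
            into : (F ∪ W) ∪ P ⊆ (F ∪ P) ∪ W
            into = ∪-lub (∪-lub (λ z∈ → p⊆p∪q W (p⊆p∪q P z∈)) (q⊆p∪q (F ∪ P) W))
                         (λ z∈ → p⊆p∪q W (q⊆p∪q F P z∈))
        in match-⊆ into (match-widen (∪-lub (p─q⊆p K T) T⊆K)
             (match-∪ (∈─⇒∉ K T) (pairs x∈ y∈ x≢y) g)))
      (λ {J} J⊆C f → rank≤2 J⊆C (outside-T J J⊆C f))
    where
    outside-T : ∀ J → J ⊆ C → Match ((F ∪ W) ∪ J) K → Match (F ∪ J) (K ─ T)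
    outside-T J J⊆C f = record
      { assign     = assign f
      ; assign∈K   = λ x∈ → x∈p∧x∉q⇒x∈p─q (assign∈K f (FJ⊆ x∈)) (∉T x∈)
      ; assign∈S   = λ x∈ → assign∈S f (FJ⊆ x∈)
      ; assign-inj = λ x∈ y∈ → assign-inj f (FJ⊆ x∈) (FJ⊆ y∈)
      }
      where
      FJ⊆ : F ∪ J ⊆ (F ∪ W) ∪ J
      FJ⊆ = ∪-lub (λ x∈ → p⊆p∪q J (p⊆p∪q W x∈)) (q⊆p∪q (F ∪ W) J)
      ∉T : ∀ {x} → x ∈ F ∪ J → assign f x ∉ T
      -- All of `W` is sent into `T`; if `x` went there too, `T` would have to hold `W ∪ ⁅ x ⁆`, for
      -- which it is too small.
      ∉T {x} x∈ fx∈T = contradiction (match-size Wx↦T) (<⇒≱ (≤-trans (s≤s T≤W)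
        (≤-reflexive (sym (x∉p⇒∣p∪⁅x⁆∣≡1+∣p∣
          (Y∌W (∪-lub F⊆ (λ y∈ → C⊆ (J⊆C y∈)) x∈)))))))
        where
        Wx⊆ : W ∪ ⁅ x ⁆ ⊆ (F ∪ W) ∪ J
        Wx⊆ = ∪-lub (λ y∈ → p⊆p∪q J (q⊆p∪q F W y∈)) (⁅⁆⊆ (FJ⊆ x∈))
        Wx↦T : Match (W ∪ ⁅ x ⁆) T
        Wx↦T .assign = assign f
        Wx↦T .assign∈K y∈ with x∈p∪q⁻ W ⁅ x ⁆ y∈
        ... | inj₁ y∈W = supp y∈W (assign∈K f (Wx⊆ y∈)) (assign∈S f (Wx⊆ y∈))
        ... | inj₂ y∈x = subst (λ z → assign f z ∈ T) (sym (x∈⁅y⁆⇒x≡y x y∈x)) fx∈T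
        Wx↦T .assign∈S y∈ = assign∈S f (Wx⊆ y∈)
        Wx↦T .assign-inj y∈ z∈ = assign-inj f (Wx⊆ y∈) (Wx⊆ z∈)

  -- Contracting I merges the indices of T into a single one, whereas
  -- contracting I ∪ ⁅ h ⁆ removes all of them.
  record Tree (K : Subset b) (X : Subset n) (T : Subset b) (I : Subset n) (h : Fin n) : Set where
    field
      T⊆K       : T ⊆ K
      I⊆X       : I ⊆ X
      h∈X       : h ∈ X
      h∉I       : h ∉ I
      supported : SupportedOn K T (I ∪ ⁅ h ⁆)
      near      : ∀ {t} → t ∈ T → Match I (T - t)
      full      : Match (I ∪ ⁅ h ⁆) T
      size      : suc ∣ I ∣ ≡ ∣ T ∣
    I-supported : SupportedOn K T I
    I-supported x∈ = supported (p⊆p∪q ⁅ h ⁆ x∈)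
    h-supported : ∀ {k} → k ∈ K → k ∈ S h → k ∈ T
    h-supported = supported (q⊆p∪q I ⁅ h ⁆ (x∈⁅x⁆ h))
  open Tree

  -- Discarding `T` would leave `x` with `k` as its only index, which might create a parallel pair
  -- that is not parallel over `K`. Absorbing `k` into `T` avoids this.
  Grows : Subset b → Subset b → Fin n → Fin b → Fin b → Set
  Grows K T x k s = k ∈ K × k ∈ S x × k ∉ T × s ∈ T × s ∈ S x ×
    (∀ j → j ∈ K → j ∈ S x → j ∉ T → j ≡ k)

  grows? : ∀ K T x k s → Dec (Grows K T x k s)
  grows? K T x k s = (k ∈? K) ×-dec (k ∈? S x) ×-dec ¬? (k ∈? T) ×-dec (s ∈? T) ×-dec
    (s ∈? S x) ×-dec
    all? λ j → (j ∈? K) →-dec ((j ∈? S x) →-dec (¬? (j ∈? T) →-dec (j ≟ k)))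

  -- `x` joins the new index `k` to an index `s` of `T`, like an edge that attaches a leaf to a
  -- tree, and it has no index beyond `T ∪ ⁅ k ⁆`.
  grow : ∀ {K X T I h x k s} → Tree K X T I h → x ∈ X → Grows K T x k s →
    Tree K X (T ∪ ⁅ k ⁆) (I ∪ ⁅ x ⁆) h
  grow tree x∈X (k∈K , _) .T⊆K = ∪-lub (T⊆K tree) (⁅⁆⊆ k∈K)
  grow tree x∈X _ .I⊆X = ∪-lub (I⊆X tree) (⁅⁆⊆ x∈X)
  grow tree x∈X _ .h∈X = h∈X tree
  grow {I = I} {x = x} tree x∈X (k∈K , k∈S , k∉T , _) .h∉I h∈ with x∈p∪q⁻ I ⁅ x ⁆ h∈
  ... | inj₁ h∈I = h∉I tree h∈I
  ... | inj₂ h∈x with x∈⁅y⁆⇒x≡y x h∈x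
  ...   | refl = k∉T (h-supported tree k∈K k∈S)
  grow {K} {X} {T} {I} {h} {x} {k} {s} tree x∈X (k∈K , k∈S , k∉T , s∈T , s∈S , only) .supported {y} {j} y∈ j∈K j∈S
    with j ∈? T
  ... | yes j∈T = p⊆p∪q ⁅ k ⁆ j∈T
  ... | no  j∉T with x∈p∪q⁻ (I ∪ ⁅ x ⁆) ⁅ h ⁆ y∈
  ... | inj₂ y∈h = contradiction (supported tree (q⊆p∪q I ⁅ h ⁆ y∈h) j∈K j∈S) j∉T
  ... | inj₁ y∈Ix with x∈p∪q⁻ I ⁅ x ⁆ y∈Ix
  ... | inj₁ y∈I = contradiction (I-supported tree y∈I j∈K j∈S) j∉T
  ... | inj₂ y∈x with x∈⁅y⁆⇒x≡y x y∈x
  ... | refl = q⊆p∪q T ⁅ k ⁆ (subst (_∈ ⁅ k ⁆) (sym (only j j∈K j∈S j∉T)) (x∈⁅x⁆ k))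
  grow {K} {X} {T} {I} {h} {x} {k} {s} tree x∈X (k∈K , k∈S , k∉T , s∈T , s∈S , only) .near {t} t∈
    with t ≟ k
  -- The index to avoid is `k`: `x` takes `s`, which `I` leaves free.
  ... | yes refl = match-widen
    (λ j∈T → x∈p∧x≢y⇒x∈p-y (p⊆p∪q ⁅ k ⁆ j∈T) λ { refl → k∉T j∈T })
    (match-insert (near tree s∈T) s∈T s∈S)
  -- The index to avoid lies in `T`: `I` avoids it already, and `x` takes `k`.
  ... | no  t≢k = match-widen
    (∪-lub (λ j∈ → x∈p∧x≢y⇒x∈p-y (p⊆p∪q ⁅ k ⁆ (p-x⊆p T t j∈)) (x∈p-y⇒x≢y T t j∈))
           (⁅⁆⊆ (x∈p∧x≢y⇒x∈p-y (q⊆p∪q T ⁅ k ⁆ (x∈⁅x⁆ k)) λ k≡t → t≢k (sym k≡t))))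
    (match-∪ (λ j∈ → x≢y⇒x∉⁅y⁆ λ { refl → k∉T (p-x⊆p T t j∈) }) (near tree t∈T) (match-⁅⁆ k∈S))
    where
    t∈T : t ∈ T
    t∈T = [ id , (λ t∈k → contradiction (x∈⁅y⁆⇒x≡y k t∈k) t≢k) ]′ (x∈p∪q⁻ T ⁅ k ⁆ t∈)
  grow {K} {X} {T} {I} {h} {x} {k} {s} tree x∈X (k∈K , k∈S , k∉T , _) .full = match-⊆
    (∪-lub (∪-lub (λ y∈ → p⊆p∪q ⁅ x ⁆ (p⊆p∪q ⁅ h ⁆ y∈)) (q⊆p∪q (I ∪ ⁅ h ⁆) ⁅ x ⁆))
           (λ y∈ → p⊆p∪q ⁅ x ⁆ (q⊆p∪q I ⁅ h ⁆ y∈)))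
    (match-∪ (λ j∈T → x≢y⇒x∉⁅y⁆ λ { refl → k∉T j∈T }) (full tree) (match-⁅⁆ k∈S))
  grow tree x∈X (k∈K , k∈S , k∉T , _) .size = trans
    (cong suc (trans (x∉p⇒∣p∪⁅x⁆∣≡1+∣p∣ λ x∈I → k∉T (I-supported tree x∈I k∈K k∈S)) (size tree)))
    (sym (x∉p⇒∣p∪⁅x⁆∣≡1+∣p∣ k∉T))

  -- `k` is one less than the number of indices, which keeps truncated subtraction out of the
  -- induction.
  Bounded : ℕ → ℕ → Set
  Bounded ℓ k = ∀ {K X} → ∣ K ∣ ≡ suc k → SimpleOn K X → NoLongLine ℓ K X → ∣ X ∣ ≤ ℓ * k + 1

  -- Induction on the number of indices

  module _ {ℓ} (1≤ℓ : 1 ≤ ℓ) where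

    -- With a single index all traces coincide, so two distinct elements would be parallel.
    bounded-1 : Bounded ℓ 0
    bounded-1 {K} {X} ∣K∣≡1 simple _ = ≤-trans
      (injection⇒∣p∣≤∣q∣ {R = λ x k → k ∈ S x} X K (trace simple) unique)
      (≤-trans (≤-reflexive ∣K∣≡1) (m≤n+m 1 (ℓ * 0)))
      where
      unique : ∀ {x y k} → x ∈ X → y ∈ X → k ∈ S x → k ∈ S y → x ≡ y
      unique {x} {y} {k} x∈X y∈X k∈Sx k∈Sy = decidable-stable (x ≟ y) λ x≢y →
        apart simple {k = proj₁ (trace simple x∈X)} x∈X y∈X x≢y only only
        where
        only : ∀ {z j} → j ∈ K → j ∈ S z → j ≡ proj₁ (trace simple x∈X)
        only j∈K _ = ∣p∣≤1⇒unique (≤-reflexive ∣K∣≡1) j∈K (proj₁ (proj₂ (trace simple x∈X)))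

    -- If `X` has more elements than `K`, contract any `k` of them: the others form a line of at
    -- most `ℓ + 1` points, and `ℓ + 1 + k` is within the bound because `1 ≤ ℓ`.
    bounded-uniform : ∀ {k K X} → ∣ K ∣ ≡ suc (suc k) → NoLongLine ℓ K X →
      (∀ {I} → I ⊆ X → ∣ I ∣ ≤ ∣ K ∣ → Match I K) → ∣ X ∣ ≤ ℓ * suc k + 1
    bounded-uniform {k} {K} {X} ∣K∣≡ short uniform with ∣ X ∣ ≤? ∣ K ∣
    ... | yes X≤K = begin
      ∣ X ∣              ≤⟨ X≤K ⟩
      ∣ K ∣              ≡⟨ ∣K∣≡ ⟩
      suc (suc k)        ≡⟨ +-comm 1 (suc k) ⟩
      suc k + 1          ≡⟨ cong (_+ 1) (*-identityˡ (suc k)) ⟨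
      1 * suc k + 1      ≤⟨ +-monoˡ-≤ 1 (*-monoˡ-≤ (suc k) 1≤ℓ) ⟩
      ℓ * suc k + 1      ∎
      where open ≤-Reasoning
    ... | no  X≰K with subset-of-size X k (≤-trans (≤-trans (n≤1+n k) (n≤1+n (suc k)))
                         (≤-trans (≤-reflexive (sym ∣K∣≡)) (≰⇒≥ X≰K)))
    ... | F , F⊆X , ∣F∣≡k = begin
      ∣ X ∣                    ≤⟨ ∣p∣≤∣p─q∣+∣q∣ X F ⟩
      ∣ X ─ F ∣ + ∣ F ∣        ≤⟨ +-mono-≤ (short F⊆X (p─q⊆p X F) (∈─⇒∉ X F) pairs rank≤2)
                                           (≤-reflexive ∣F∣≡k) ⟩
      suc ℓ + k                ≡⟨ +-comm 1 (ℓ + k) ⟩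
      ℓ + k + 1                ≡⟨ cong (λ m → ℓ + m + 1) (*-identityˡ k) ⟨
      ℓ + 1 * k + 1            ≤⟨ +-monoˡ-≤ 1 (+-monoʳ-≤ ℓ (*-monoˡ-≤ k 1≤ℓ)) ⟩
      ℓ + ℓ * k + 1            ≡⟨ cong (_+ 1) (*-suc ℓ k) ⟨
      ℓ * suc k + 1            ∎
      where
      open ≤-Reasoning
      k+2≡∣K∣ : ∣ F ∣ + 2 ≡ ∣ K ∣
      k+2≡∣K∣ = trans (cong (_+ 2) ∣F∣≡k) (trans (+-comm k 2) (sym ∣K∣≡))
      pairs : ∀ {x y} → x ∈ X ─ F → y ∈ X ─ F → x ≢ y → Match (F ∪ (⁅ x ⁆ ∪ ⁅ y ⁆)) K
      pairs {x} {y} x∈ y∈ _ = uniform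
        (∪-lub F⊆X (∪-lub (⁅⁆⊆ (p─q⊆p X F x∈)) (⁅⁆⊆ (p─q⊆p X F y∈))))
        (begin
          ∣ F ∪ (⁅ x ⁆ ∪ ⁅ y ⁆) ∣              ≤⟨ ∣∪∣≤ F (⁅ x ⁆ ∪ ⁅ y ⁆) ⟩
          ∣ F ∣ + ∣ ⁅ x ⁆ ∪ ⁅ y ⁆ ∣            ≤⟨ +-monoʳ-≤ ∣ F ∣ (∣p∪⁅x⁆∣≤1+∣p∣ ⁅ x ⁆ y) ⟩
          ∣ F ∣ + suc ∣ ⁅ x ⁆ ∣                ≡⟨ cong (λ m → ∣ F ∣ + suc m) (∣⁅x⁆∣≡1 x) ⟩
          ∣ F ∣ + 2                            ≡⟨ k+2≡∣K∣ ⟩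
          ∣ K ∣                                ∎)
      rank≤2 : ∀ {J} → J ⊆ X ─ F → Match (F ∪ J) K → ∣ J ∣ ≤ 2
      rank≤2 {J} J⊆ f = +-cancelˡ-≤ ∣ F ∣ _ _ (begin
        ∣ F ∣ + ∣ J ∣  ≤⟨ ∣∪∣≥ F J (λ x∈F x∈J → ∈─⇒∉ X F (J⊆ x∈J) x∈F) ⟩
        ∣ F ∪ J ∣      ≤⟨ match-size f ⟩
        ∣ K ∣          ≡⟨ k+2≡∣K∣ ⟨
        ∣ F ∣ + 2      ∎)

    -- `P` consists of the elements meeting the one index `j` outside `T`. Contracting `I` makes
    -- `P ∪ ⁅ h ⁆` a line, and the place taken by `h` improves the bound on `P` from `ℓ + 1` to `ℓ`,
    -- exactly what one more index may add.
    bounded-hyperplane : ∀ {k K X T I h} → ∣ K ∣ ≡ suc ∣ T ∣ → ∣ T ∣ ≡ suc k →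
      SimpleOn K X → NoLongLine ℓ K X → Tree K X T I h → Bounded ℓ k → ∣ X ∣ ≤ ℓ * suc k + 1
    bounded-hyperplane {k} {K} {X} {T} {I} {h} ∣K∣≡ ∣T∣≡ simple short tree bound = begin
      ∣ X ∣                   ≤⟨ ∣p∣≤∣p─q∣+∣q∣ X P ⟩
      ∣ X ─ P ∣ + ∣ P ∣       ≤⟨ +-mono-≤ X─P-bound P≤ℓ ⟩
      ℓ * k + 1 + ℓ           ≡⟨ +-comm (ℓ * k + 1) ℓ ⟩
      ℓ + (ℓ * k + 1)         ≡⟨ +-assoc ℓ (ℓ * k) 1 ⟨
      ℓ + ℓ * k + 1           ≡⟨ cong (_+ 1) (*-suc ℓ k) ⟨
      ℓ * suc k + 1           ∎
      where
      open ≤-Reasoning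
      ∣K─T∣≡1 : ∣ K ─ T ∣ ≡ 1
      ∣K─T∣≡1 = +-cancelʳ-≡ ∣ T ∣ _ _ (trans (q⊆p⇒∣p─q∣+∣q∣≡∣p∣ (T⊆K tree)) ∣K∣≡)
      missing : Nonempty (K ─ T)
      missing = 0<∣p∣⇒Nonempty (K ─ T) (≤-reflexive (sym ∣K─T∣≡1))
      j : Fin b
      j = proj₁ missing
      j∈K : j ∈ K
      j∈K = p─q⊆p K T (proj₂ missing)
      j∉T : j ∉ T
      j∉T = ∈─⇒∉ K T (proj₂ missing)
      ∉T⇒≡j : ∀ {i} → i ∈ K → i ∉ T → i ≡ j
      ∉T⇒≡j i∈K i∉T = ∣p∣≤1⇒unique (≤-reflexive ∣K─T∣≡1) (x∈p∧x∉q⇒x∈p─q i∈K i∉T) (proj₂ missing)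
      meets? : ∀ x → Dec (x ∈ X × j ∈ S x)
      meets? x = (x ∈? X) ×-dec (j ∈? S x)
      P = select meets?
      P⁻ : ∀ {x} → x ∈ P → x ∈ X × j ∈ S x
      P⁻ = ∈-select⁻ meets?
      X─P-supported : SupportedOn K T (X ─ P)
      X─P-supported {x} {i} x∈ i∈K i∈S = decidable-stable (i ∈? T) λ i∉T → ∈─⇒∉ X P x∈
        (∈-select⁺ meets? (p─q⊆p X P x∈ , subst (_∈ S x) (∉T⇒≡j i∈K i∉T) i∈S))
      X─P-bound : ∣ X ─ P ∣ ≤ ℓ * k + 1
      X─P-bound = bound ∣T∣≡ (SimpleOn-restrict (T⊆K tree) (p─q⊆p X P) X─P-supported simple)
        (NoLongLine-restrict (T⊆K tree) (p─q⊆p X P) X─P-supported short)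
      h∉P : h ∉ P
      h∉P h∈P = j∉T (h-supported tree j∈K (proj₂ (P⁻ h∈P)))
      C = P ∪ ⁅ h ⁆
      T+j⊆K : T ∪ ⁅ j ⁆ ⊆ K
      T+j⊆K = ∪-lub (T⊆K tree) (⁅⁆⊆ j∈K)
      T∌j : ∀ {i} → i ∈ T → i ∉ ⁅ j ⁆
      T∌j i∈T = x≢y⇒x∉⁅y⁆ λ { refl → j∉T i∈T }
      swap : ∀ {x y} → I ∪ (⁅ x ⁆ ∪ ⁅ y ⁆) ⊆ I ∪ (⁅ y ⁆ ∪ ⁅ x ⁆)
      swap {x} {y} {z} = subst (λ q → z ∈ I ∪ q) (∪-comm ⁅ x ⁆ ⁅ y ⁆)
      pair : ∀ {x y} → Match (I ∪ ⁅ x ⁆) T → j ∈ S y → Match (I ∪ (⁅ x ⁆ ∪ ⁅ y ⁆)) K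
      pair {x} {y} f j∈Sy = subst (λ J → Match J K) (∪-assoc I ⁅ x ⁆ ⁅ y ⁆)
        (match-widen T+j⊆K (match-∪ T∌j f (match-⁅⁆ j∈Sy)))
      meets-T? : ∀ x → Dec (∃ λ s → s ∈ T × s ∈ S x)
      meets-T? x = any? λ s → (s ∈? T) ×-dec (s ∈? S x)
      only-j : ∀ {x} → ¬ (∃ λ s → s ∈ T × s ∈ S x) → ∀ {i} → i ∈ K → i ∈ S x → i ≡ j
      only-j ∄ i∈K i∈S = ∉T⇒≡j i∈K λ i∈T → ∄ (_ , i∈T , i∈S)
      pairs : ∀ {x y} → x ∈ C → y ∈ C → x ≢ y → Match (I ∪ (⁅ x ⁆ ∪ ⁅ y ⁆)) K
      pairs {x} {y} x∈ y∈ x≢y with x∈p∪q⁻ P ⁅ h ⁆ x∈ | x∈p∪q⁻ P ⁅ h ⁆ y∈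
      ... | inj₂ x∈h | inj₂ y∈h = contradiction (trans (x∈⁅y⁆⇒x≡y h x∈h) (sym (x∈⁅y⁆⇒x≡y h y∈h))) x≢y
      ... | inj₂ x∈h | inj₁ y∈P with x∈⁅y⁆⇒x≡y h x∈h
      ...   | refl = pair (full tree) (proj₂ (P⁻ y∈P))
      pairs {x} {y} x∈ y∈ x≢y | inj₁ x∈P | inj₂ y∈h with x∈⁅y⁆⇒x≡y h y∈h
      ...   | refl = match-⊆ swap (pair (full tree) (proj₂ (P⁻ x∈P)))
      pairs {x} {y} x∈ y∈ x≢y | inj₁ x∈P | inj₁ y∈P with meets-T? x | meets-T? y
      -- Whichever of the two meets `T` takes an index `s` there, with `I` matched around it, and
      -- the other takes `j`. If neither met `T`, both would meet `K` in `j` alone and be parallel.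
      ... | yes (s , s∈T , s∈S) | _ = pair (match-insert (near tree s∈T) s∈T s∈S) (proj₂ (P⁻ y∈P))
      ... | no _ | yes (s , s∈T , s∈S) =
        match-⊆ swap (pair (match-insert (near tree s∈T) s∈T s∈S) (proj₂ (P⁻ x∈P)))
      ... | no ∄x | no ∄y = ⊥-elim
        (apart simple (proj₁ (P⁻ x∈P)) (proj₁ (P⁻ y∈P)) x≢y (only-j ∄x) (only-j ∄y))
      C∌I : ∀ {x} → x ∈ C → x ∉ I
      C∌I x∈C x∈I with x∈p∪q⁻ P ⁅ h ⁆ x∈C
      ... | inj₁ x∈P = j∉T (I-supported tree x∈I j∈K (proj₂ (P⁻ x∈P)))
      ... | inj₂ x∈h with x∈⁅y⁆⇒x≡y h x∈h
      ...   | refl = h∉I tree x∈I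
      rank≤2 : ∀ {J} → J ⊆ C → Match (I ∪ J) K → ∣ J ∣ ≤ 2
      rank≤2 {J} J⊆C f = +-cancelˡ-≤ ∣ I ∣ _ _ (begin
        ∣ I ∣ + ∣ J ∣    ≤⟨ ∣∪∣≥ I J (λ x∈I x∈J → C∌I (J⊆C x∈J) x∈I) ⟩
        ∣ I ∪ J ∣        ≤⟨ match-size f ⟩
        ∣ K ∣            ≡⟨ ∣K∣≡ ⟩
        suc ∣ T ∣        ≡⟨ cong suc (size tree) ⟨
        2 + ∣ I ∣        ≡⟨ +-comm 2 ∣ I ∣ ⟩
        ∣ I ∣ + 2        ∎)
      P≤ℓ : ∣ P ∣ ≤ ℓ
      P≤ℓ = ≤-pred (≤-trans (≤-reflexive (sym (x∉p⇒∣p∪⁅x⁆∣≡1+∣p∣ h∉P)))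
        (short (I⊆X tree) (∪-lub (λ x∈ → proj₁ (P⁻ x∈)) (⁅⁆⊆ (h∈X tree))) C∌I pairs rank≤2))

    -- The point is that `X₂` stays simple over `K ─ T`: an element with a single index outside `T`
    -- cannot also meet `T`, as the tree could then grow, so a parallel pair over `K ─ T` would be
    -- one over `K`.
    bounded-split : ∀ {m k K X T I h} → ∣ K ∣ ≡ suc m + ∣ T ∣ → ∣ T ∣ ≡ suc k →
      SimpleOn K X → NoLongLine ℓ K X → Tree K X T I h →
      (∀ {x} → x ∈ X → ∀ k s → ¬ Grows K T x k s) →
      Bounded ℓ k → Bounded ℓ m → ∣ X ∣ ≤ ℓ * (m + suc k) + 1
    bounded-split {m} {k} {K} {X} {T} {I} {h} ∣K∣≡ ∣T∣≡ simple short tree stuck bound-T bound-R = begin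
      ∣ X ∣                              ≤⟨ ∣p∣≤∣p─q∣+∣q∣ X X₁ ⟩
      -- The two bounds together have one summand 1 too many; it is absorbed into the `ℓ` that turns
      -- `m + k` into `m + suc k`.
      ∣ X₂ ∣ + ∣ X₁ ∣                    ≤⟨ +-mono-≤ X₂-bound X₁-bound ⟩
      (ℓ * m + 1) + (ℓ * k + 1)          ≤⟨ +-monoˡ-≤ (ℓ * k + 1) (+-monoʳ-≤ (ℓ * m) 1≤ℓ) ⟩
      (ℓ * m + ℓ) + (ℓ * k + 1)          ≡⟨ +-assoc (ℓ * m + ℓ) (ℓ * k) 1 ⟨
      (ℓ * m + ℓ) + ℓ * k + 1            ≡⟨ cong (_+ 1) (+-assoc (ℓ * m) ℓ (ℓ * k)) ⟩
      ℓ * m + (ℓ + ℓ * k) + 1            ≡⟨ cong (λ i → ℓ * m + i + 1) (*-suc ℓ k) ⟨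
      ℓ * m + ℓ * suc k + 1              ≡⟨ cong (_+ 1) (*-distribˡ-+ ℓ m (suc k)) ⟨
      ℓ * (m + suc k) + 1                ∎
      where
      open ≤-Reasoning
      inside? : ∀ x → Dec (x ∈ X × (∀ i → i ∈ K → i ∈ S x → i ∈ T))
      inside? x = (x ∈? X) ×-dec all? λ i → (i ∈? K) →-dec ((i ∈? S x) →-dec (i ∈? T))
      X₁ = select inside?
      X₂ = X ─ X₁
      X₁⁻ : ∀ {x} → x ∈ X₁ → x ∈ X × (∀ i → i ∈ K → i ∈ S x → i ∈ T)
      X₁⁻ = ∈-select⁻ inside?
      X₁⊆X : X₁ ⊆ X
      X₁⊆X x∈ = proj₁ (X₁⁻ x∈)
      X₂⊆X : X₂ ⊆ X
      X₂⊆X = p─q⊆p X X₁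
      X₁-supported : SupportedOn K T X₁
      X₁-supported x∈ = proj₂ (X₁⁻ x∈) _
      X₁-bound : ∣ X₁ ∣ ≤ ℓ * k + 1
      X₁-bound = bound-T ∣T∣≡ (SimpleOn-restrict (T⊆K tree) X₁⊆X X₁-supported simple)
        (NoLongLine-restrict (T⊆K tree) X₁⊆X X₁-supported short)
      W⊆X : I ∪ ⁅ h ⁆ ⊆ X
      W⊆X = ∪-lub (I⊆X tree) (⁅⁆⊆ (h∈X tree))
      X₂∌W : ∀ {x} → x ∈ X₂ → x ∉ I ∪ ⁅ h ⁆
      X₂∌W x∈X₂ x∈W = ∈─⇒∉ X X₁ x∈X₂
        (∈-select⁺ inside? (W⊆X x∈W , λ i i∈K i∈S → supported tree x∈W i∈K i∈S))
      T≤W : ∣ T ∣ ≤ ∣ I ∪ ⁅ h ⁆ ∣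
      T≤W = ≤-reflexive (trans (sym (size tree)) (sym (x∉p⇒∣p∪⁅x⁆∣≡1+∣p∣ (h∉I tree))))
      trace₂ : ∀ {x} → x ∈ X₂ → ∃ λ i → i ∈ K ─ T × i ∈ S x
      trace₂ {x} x∈ with any? (λ i → (i ∈? K ─ T) ×-dec (i ∈? S x))
      ... | yes found = found
      ... | no  ∄ = contradiction (∈-select⁺ inside? (X₂⊆X x∈ , λ i i∈K i∈S →
        decidable-stable (i ∈? T) λ i∉T → ∄ (i , x∈p∧x∉q⇒x∈p─q i∈K i∉T , i∈S))) (∈─⇒∉ X X₁ x∈)
      only : ∀ {x i} → x ∈ X₂ → (∀ {j} → j ∈ K ─ T → j ∈ S x → j ≡ i) →
        ∀ {j} → j ∈ K → j ∈ S x → j ≡ i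
      only {x} {i} x∈ x-only {j} j∈K j∈S with j ∈? T
      ... | no  j∉T = x-only (x∈p∧x∉q⇒x∈p─q j∈K j∉T) j∈S
      ... | yes j∈T = contradiction
        (let i′ , i′∈ , i′∈S = trace₂ x∈ in p─q⊆p K T i′∈ , i′∈S , ∈─⇒∉ K T i′∈ , j∈T , j∈S ,
          λ l l∈K l∈S l∉T → trans (x-only (x∈p∧x∉q⇒x∈p─q l∈K l∉T) l∈S) (sym (x-only i′∈ i′∈S)))
        (stuck (X₂⊆X x∈) (proj₁ (trace₂ x∈)) j)
      simple₂ : SimpleOn (K ─ T) X₂
      simple₂ .trace = trace₂
      simple₂ .apart x∈ y∈ x≢y x-only y-only =
        apart simple (X₂⊆X x∈) (X₂⊆X y∈) x≢y (only x∈ x-only) (only y∈ y-only)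
      X₂-bound : ∣ X₂ ∣ ≤ ℓ * m + 1
      X₂-bound = bound-R (+-cancelʳ-≡ ∣ T ∣ _ _ (trans (q⊆p⇒∣p─q∣+∣q∣≡∣p∣ (T⊆K tree)) ∣K∣≡)) simple₂
        (NoLongLine-contract (T⊆K tree) X₂⊆X W⊆X X₂∌W (supported tree) (full tree) T≤W short)

    -- There are `suc d` indices outside `T`, so `d` drops with each growth. The recursion stops
    -- when a single index is left, before `T` could swallow all of `K`.
    bounded-tree : ∀ d {k K X T I h} → ∣ K ∣ ≡ suc k → ∣ K ∣ ≡ suc d + ∣ T ∣ →
      SimpleOn K X → NoLongLine ℓ K X → Tree K X T I h →
      (∀ {m} → m < k → Bounded ℓ m) → ∣ X ∣ ≤ ℓ * k + 1
    bounded-tree zero {k} {K} {X} {T} {I} ∣K∣≡ ∣K∣≡′ simple short tree bound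
      with suc-injective (trans (sym ∣K∣≡) (trans ∣K∣≡′ (cong suc (sym (size tree)))))
    ... | refl = bounded-hyperplane ∣K∣≡′ (sym (size tree)) simple short tree (bound ≤-refl)
    bounded-tree (suc d) {k} {K} {X} {T} {I} ∣K∣≡ ∣K∣≡′ simple short tree bound
      with any? (λ x → (x ∈? X) ×-dec any? λ k → any? λ s → grows? K T x k s)
    ... | yes (x , x∈X , i , s , grows@(_ , _ , i∉T , _)) =
      bounded-tree d ∣K∣≡ (trans ∣K∣≡′ (trans (sym (cong suc (+-suc d ∣ T ∣)))
        (cong (suc d +_) (sym (x∉p⇒∣p∪⁅x⁆∣≡1+∣p∣ i∉T)))))
        simple short (grow tree x∈X grows) bound
    ... | no ∄ with suc-injective (trans (sym ∣K∣≡) (trans ∣K∣≡′ (cong (2 + d +_) (sym (size tree)))))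
    ... | refl = bounded-split ∣K∣≡′ (sym (size tree)) simple short tree
      (λ x∈X i s grows → ∄ (_ , x∈X , i , s , grows))
      (bound (m≤n+m (suc ∣ I ∣) (suc d))) (bound (m<m+n (suc d) (s≤s z≤n)))

    -- By minimality every nonempty proper subset of `J` has surplus. Hence `J - h` can be matched
    -- around any prescribed index, while `J` still satisfies Hall's condition and, being tight, has
    -- exactly `∣ J ∣` neighbours. Any element of `J` serves as `h`.
    tight⇒tree : ∀ {K X J} → SimpleOn K X → IsTight ∣ K ∣ X K J →
      (∀ L → IsTight ∣ K ∣ X K L → ∣ J ∣ ≤ ∣ L ∣) →
      ∃ λ T → ∃ λ I → ∃ λ h → ∣ T ∣ < ∣ K ∣ × Tree K X T I h
    tight⇒tree {K} {X} {J} simple (J⊆X , (h , h∈J) , J<K , tight) minimal =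
      neighbours J K , J - h , h , ≤-<-trans tight J<K , record
        { T⊆K       = λ t∈ → proj₁ (∈-neighbours⁻ J K t∈)
        ; I⊆X       = λ x∈ → J⊆X (p-x⊆p J h x∈)
        ; h∈X       = J⊆X h∈J
        ; h∉I       = x∉p-x J h
        ; supported = λ x∈ → ∈-neighbours⁺ (Jh⊆J x∈)
        ; near      = λ {t} _ → match-into
            (λ x∈ k∈ k∈S → x∈p∧x≢y⇒x∈p-y
              (∈-neighbours⁺ (p-x⊆p J h x∈) (p-x⊆p K t k∈) k∈S) (x∈p-y⇒x≢y K t k∈))
            (hall⇒match (hall-delete λ L⊆ ne → surplus (λ x∈ → p-x⊆p J h (L⊆ x∈)) ne
              (≤-<-trans (p⊆q⇒∣p∣≤∣q∣ L⊆) (x∈p⇒∣p-x∣<∣p∣ h∈J))))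
        ; full      = match-into (λ x∈ → ∈-neighbours⁺ (Jh⊆J x∈)) (match-⊆ Jh⊆J (hall⇒match hall))
        ; size      = trans (x∈p⇒1+∣p-x∣≡∣p∣ h∈J) (≤-antisym (hall id) tight)
        }
      where
      Jh⊆J : (J - h) ∪ ⁅ h ⁆ ⊆ J
      Jh⊆J = ∪-lub (p-x⊆p J h) (⁅⁆⊆ h∈J)
      surplus : ∀ {L} → L ⊆ J → Nonempty L → ∣ L ∣ < ∣ J ∣ → ∣ L ∣ < ∣ neighbours L K ∣
      surplus L⊆J ne L<J = ≰⇒> λ L-tight → contradiction L<J
        (≤⇒≯ (minimal _ ((λ x∈ → J⊆X (L⊆J x∈)) , ne , <-trans L<J J<K , L-tight)))
      hall : Hall J K
      hall = surplus⇒hall (λ x∈ → trace simple (J⊆X x∈)) surplus id ≤-refl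

    bounded-step : ∀ {k} → (∀ {m} → m < k → Bounded ℓ m) → Bounded ℓ k
    bounded-step {zero} bound = bounded-1
    bounded-step {suc k} bound {K} {X} ∣K∣≡ simple short with anySubset? (isTight? ∣ K ∣ X K)
    -- Tight sets were sought only below size `∣ K ∣`; `surplus⇒hall` extends Hall's condition to
    -- size `∣ K ∣`, so the matroid is uniform.
    ... | no ∄ = bounded-uniform ∣K∣≡ short λ I⊆X I≤K → hall⇒match
      (surplus⇒hall (trace simple)
        (λ J⊆X ne J<K → ≰⇒> λ tight → ∄ (_ , J⊆X , ne , J<K , tight)) I⊆X I≤K)
    ... | yes found
      with J , tight , minimal ← minimal-subset (isTight? ∣ K ∣ X K) found
      with T , I , h , T<K , tree ← tight⇒tree simple tight minimal
      = bounded-tree (∣ K ∣ ∸ suc ∣ T ∣) ∣K∣≡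
          (trans (sym (m∸n+n≡m T<K)) (+-suc (∣ K ∣ ∸ suc ∣ T ∣) ∣ T ∣)) simple short tree bound

    bounded : ∀ k → Bounded ℓ k
    bounded = <-rec (Bounded ℓ) (λ _ → bounded-step)

-- Uniform minors

enum : ∀ {n} (G : Subset n) → Fin ∣ G ∣ → Fin n
enum (outside ∷ G) i       = suc (enum G i)
enum (inside  ∷ G) zero    = zero
enum (inside  ∷ G) (suc i) = suc (enum G i)

enum-∈ : ∀ {n} (G : Subset n) i → enum G i ∈ G
enum-∈ (outside ∷ G) i       = there (enum-∈ G i)
enum-∈ (inside  ∷ G) zero    = here
enum-∈ (inside  ∷ G) (suc i) = there (enum-∈ G i)

enum-injective : ∀ {n} (G : Subset n) {i j} → enum G i ≡ enum G j → i ≡ j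
enum-injective (outside ∷ G) eq = enum-injective G (Fin-suc-injective eq)
enum-injective (inside  ∷ G) {zero}  {zero}  eq = refl
enum-injective (inside  ∷ G) {suc i} {suc j} eq = cong suc (enum-injective G (Fin-suc-injective eq))

index : ∀ {n} (G : Subset n) {x} → x ∈ G → Fin ∣ G ∣
index (outside ∷ G) (there x∈) = index G x∈
index (inside  ∷ G) here       = zero
index (inside  ∷ G) (there x∈) = suc (index G x∈)

enum-index : ∀ {n} (G : Subset n) {x} (x∈ : x ∈ G) → enum G (index G x∈) ≡ x
enum-index (outside ∷ G) (there x∈) = cong suc (enum-index G x∈)
enum-index (inside  ∷ G) here       = refl
enum-index (inside  ∷ G) (there x∈) = cong suc (enum-index G x∈)

index-enum : ∀ {n} (G : Subset n) i → index G (enum-∈ G i) ≡ i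
index-enum G i = enum-injective G (enum-index G (enum-∈ G i))

El-≡ : ∀ {n} {G : Subset n} {d e : El G} → proj₁ d ≡ proj₁ e → d ≡ e
El-≡ {d = x , x∈} {.x , x∈′} refl = cong (x ,_) ([]=-irrelevant x∈ x∈′)

uniform-≅ : ∀ {n k m} (N : Matroid n) (k≤m : k ≤ m) → ∣ ground N ∣ ≡ m →
  (∀ {I} → I ⊆ ground N → Indep N I ⇔ ∣ I ∣ ≤ k) → N ≅ U k m k≤m
uniform-≅ {n} {k} N k≤m refl uniform = φ , λ I J I⊆ J⊆ corr →
  -- Corresponding sets have the same size: `index` injects `I` into `J`, and `enum` injects `J`
  -- into `I`.
  let I≤J = injection⇒∣p∣≤∣q∣ {R = λ x i → Σ (x ∈ G) λ x∈ → index G x∈ ≡ i} I J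
        (λ x∈I → index G (I⊆ x∈I) , Equivalence.to (corr (_ , I⊆ x∈I)) x∈I , I⊆ x∈I , refl)
        (λ { _ _ (x∈ , refl) (y∈ , eq) →
          trans (sym (enum-index G x∈)) (trans (cong (enum G) (sym eq)) (enum-index G y∈)) })
      J≤I = injection⇒∣p∣≤∣q∣ {R = λ i x → enum G i ≡ x} J I
        (λ {i} i∈J → enum G i , Equivalence.from (corr (_ , enum-∈ G i))
          (subst (_∈ J) (sym (index-enum G i)) i∈J) , refl)
        (λ _ _ eq eq′ → enum-injective G (trans eq (sym eq′)))
  in mk⇔ (λ indI → ≤-trans J≤I (Equivalence.to (uniform I⊆) indI))
         (λ J≤k → Equivalence.from (uniform I⊆) (≤-trans I≤J J≤k))
  where
  G = ground N
  φ : El G ↔ El (⊤ {∣ G ∣})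
  φ = mk↔ₛ′ (λ (x , x∈) → index G x∈ , ∈⊤) (λ (i , _) → enum G i , enum-∈ G i)
    (λ (i , _) → El-≡ (index-enum G i)) (λ (x , x∈) → El-≡ (enum-index G x∈))

-- Contract `F`, then delete all that remains outside `C`. Since `F` is independent, it is its own
-- only basis, so independence of `I` in the minor means independence of `F ∪ I` in `M`.
U₂-minor : ∀ {n m} (M : Matroid n) (2≤m : 2 ≤ m) {F C : Subset n} →
  F ⊆ ground M → C ⊆ ground M → (∀ {x} → x ∈ C → x ∉ F) → ∣ C ∣ ≡ m →
  (∀ {x y} → x ∈ C → y ∈ C → x ≢ y → Indep M (F ∪ (⁅ x ⁆ ∪ ⁅ y ⁆))) →
  (∀ {J} → J ⊆ C → Indep M (F ∪ J) → ∣ J ∣ ≤ 2) →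
  ∃ λ N → N IsMinorOf M × N ≅ U 2 m 2≤m
U₂-minor {n} {m} M 2≤m {F} {C} F⊆ C⊆ dis ∣C∣≡m pairs rank≤2 =
  N , contract F F⊆ ◅ delete D (p─q⊆p (ground M ─ F) C) ◅ ε ,
  uniform-≅ N 2≤m (trans (cong ∣_∣ (⊆-antisym G⊆C C⊆G)) ∣C∣≡m) uniform
  where
  D = (ground M ─ F) ─ C
  N = M // F \\ D
  G⊆C : ground N ⊆ C
  G⊆C {x} x∈ = decidable-stable (x ∈? C) λ x∉C →
    ∈─⇒∉ (ground M ─ F) D x∈ (x∈p∧x∉q⇒x∈p─q (p─q⊆p (ground M ─ F) D x∈) x∉C)
  C⊆G : C ⊆ ground N
  C⊆G x∈C = x∈p∧x∉q⇒x∈p─q (x∈p∧x∉q⇒x∈p─q (C⊆ x∈C) (dis x∈C))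
    λ x∈D → ∈─⇒∉ (ground M ─ F) C x∈D x∈C
  small : ∀ {I} → I ⊆ C → ∣ I ∣ ≤ 2 → Indep M (F ∪ I)
  -- Because `2 ≤ m`, the set `C` is large enough to extend `I` to a pair, to which `pairs` applies.
  small I⊆C I≤2
    with Q , I⊆Q , Q⊆C , ∣Q∣≡2 ← superset-of-size 2 I⊆C I≤2 (≤-trans 2≤m (≤-reflexive (sym ∣C∣≡m)))
    with x , y , x≢y , x∈Q , y∈Q , Q⊆xy ← ∣p∣≡2⇒pair Q ∣Q∣≡2
    = indep-⊆ M (∪-lub (p⊆p∪q (⁅ x ⁆ ∪ ⁅ y ⁆)) λ z∈ → q⊆p∪q F (⁅ x ⁆ ∪ ⁅ y ⁆) (Q⊆xy (I⊆Q z∈)))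
        (pairs (Q⊆C x∈Q) (Q⊆C y∈Q) x≢y)
  indF : Indep M F
  indF = indep-⊆ M (p⊆p∪q ⊥) (small (⊆-min C) (≤-trans (≤-reflexive (∣⊥∣≡0 n)) z≤n))
  indep⇒≤2 : ∀ {I} → Indep N I → ∣ I ∣ ≤ 2
  indep⇒≤2 {I} (I⊆G , _ , B , (_ , B⊆F , max) , ind) = rank≤2 (λ x∈ → G⊆C (I⊆G x∈))
    (indep-⊆ M (∪-lub (λ x∈F → q⊆p∪q I B (max F indF B⊆F id x∈F)) (p⊆p∪q B)) ind)
  ≤2⇒indep : ∀ {I} → I ⊆ ground N → ∣ I ∣ ≤ 2 → Indep N I
  ≤2⇒indep {I} I⊆G I≤2 = I⊆G , (λ x∈ → p─q⊆p (ground M ─ F) D (I⊆G x∈)) ,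
    F , (indF , id , λ J _ _ J⊆F → J⊆F) ,
    subst (Indep M) (∪-comm F I) (small (λ x∈ → G⊆C (I⊆G x∈)) I≤2)
  uniform : ∀ {I} → I ⊆ ground N → Indep N I ⇔ ∣ I ∣ ≤ 2
  uniform I⊆G = mk⇔ indep⇒≤2 (≤2⇒indep I⊆G)

-- Transversal matroids in terms of matchings

module _ {n b} (M : Matroid n) {P : Fin (suc b) → Subset n} (presents : Presents P M) where

  private
    contains? : ∀ x i → Dec (x ∈ P i)
    contains? x i = x ∈? P i

    S : Fin n → Subset (suc b)
    S x = select (contains? x)

  -- `zero` is the default index, available because the family has `suc b` members.
  open Matchings S zero

  match⇒⊆ground : ∀ {I K} → Match I K → I ⊆ ground M
  match⇒⊆ground f x∈ = proj₁ presents _ (∈-select⁻ (contains? _) (assign∈S f x∈))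

  match⇒indep : ∀ {I K} → Match I K → Indep M I
  match⇒indep {I} f = Equivalence.from (proj₂ presents I (match⇒⊆ground f))
    ( (λ (x , _) → assign f x)
    , (λ {(x , x∈)} {(y , y∈)} eq → El-≡ (assign-inj f x∈ y∈ eq))
    , (λ (x , x∈) → ∈-select⁻ (contains? x) (assign∈S f x∈)) )

  indep⇒match : ∀ {I} → Indep M I → Match I ⊤
  indep⇒match {I} ind = record
    { assign     = choose
    ; assign∈K   = λ _ → ∈⊤
    ; assign∈S   = choose∈S
    ; assign-inj = choose-inj
    }
    where
    transversal = Equivalence.to (proj₂ presents I (indep⊆ground M ind)) ind
    f = proj₁ transversal
    choose : Fin n → Fin (suc b)
    choose x with x ∈? I
    ... | yes x∈ = f (x , x∈)
    ... | no  _  = zero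
    choose∈S : ∀ {x} → x ∈ I → choose x ∈ S x
    choose∈S {x} x∈ with x ∈? I
    ... | yes x∈′ = ∈-select⁺ (contains? x) (proj₂ (proj₂ transversal) (x , x∈′))
    ... | no  x∉  = contradiction x∈ x∉
    choose-inj : ∀ {x y} → x ∈ I → y ∈ I → choose x ≡ choose y → x ≡ y
    choose-inj {x} {y} x∈ y∈ eq with x ∈? I | y ∈? I
    ... | yes _  | yes _  = cong proj₁ (proj₁ (proj₂ transversal) eq)
    ... | no  x∉ | _      = contradiction x∈ x∉
    ... | _      | no  y∉ = contradiction y∈ y∉

  presentation-of-size-rank : ∀ {r} → HasRank M r →
    ∃ λ K → ∣ K ∣ ≡ r × (∀ {I} → Indep M I → Match I K)
  presentation-of-size-rank (B , basis@(indB , _) , refl) =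
    let g = indep⇒match indB
        K , ∣K∣≡ , suffices = maximum-match-suffices (∣ ⊤ {suc b} ∣ ∸ ∣ B ∣) g maximum
          (sym (m∸n+n≡m (match-size g)))
    in K , ∣K∣≡ , λ ind → suffices (indep⇒match ind)
    where
    maximum : ∀ {J} → Match J ⊤ → ∣ J ∣ ≤ ∣ B ∣
    maximum f = ≮⇒≥ λ B<J →
      let x , x∈J , x∉B , ind = indep-augment M indB (match⇒indep f) B<J
      in basis-∌ M (ground M) basis (match⇒⊆ground f x∈J) x∉B ind

  -- Two elements that meet `K` only in the same index compete for it in every matching, so they
  -- form a dependent pair.
  simple⇒SimpleOn : ∀ {K} → (∀ {I} → Indep M I → Match I K) → IsSimple M → SimpleOn K (ground M)
  simple⇒SimpleOn {K} match (no-loop , no-parallel) = record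
    { trace = λ {x} x∈ →
        let f = match (indep-⁅⁆ x∈)
        in assign f x , assign∈K f (x∈⁅x⁆ x) , assign∈S f (x∈⁅x⁆ x)
    ; apart = λ {x} {y} x∈ y∈ x≢y x-only y-only → no-parallel x y
        (x≢y , indep-⁅⁆ x∈ , indep-⁅⁆ y∈ , λ ind →
          let f   = match ind
              x∈′ = p⊆p∪q ⁅ y ⁆ (x∈⁅x⁆ x)
              y∈′ = q⊆p∪q ⁅ x ⁆ ⁅ y ⁆ (x∈⁅x⁆ y)
          in x≢y (assign-inj f x∈′ y∈′ (trans (x-only (assign∈K f x∈′) (assign∈S f x∈′))
                                              (sym (y-only (assign∈K f y∈′) (assign∈S f y∈′))))))
    }
    where
    indep-⁅⁆ : ∀ {x} → x ∈ ground M → Indep M ⁅ x ⁆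
    indep-⁅⁆ {x} x∈ = decidable-stable (indep? M ⁅ x ⁆) λ dep → no-loop x (x∈ , dep)

  no-minor⇒NoLongLine : ∀ {ℓ K} → (∀ {I} → Indep M I → Match I K) →
    ¬ (∃ λ (N : Matroid n) → N IsMinorOf M × N ≅ U 2 (ℓ + 2) (m≤n+m 2 ℓ)) →
    NoLongLine ℓ K (ground M)
  no-minor⇒NoLongLine {ℓ} match no-minor {F} {C} F⊆ C⊆ dis pairs rank≤2 = ≮⇒≥ λ long →
    -- `long` provides at least `ℓ + 2` points; exactly that many are kept to obtain the excluded
    -- minor.
    let C′ , C′⊆C , ∣C′∣≡ = subset-of-size C (ℓ + 2) (≤-trans (≤-reflexive (+-comm ℓ 2)) long)
    in no-minor (U₂-minor M (m≤n+m 2 ℓ) F⊆ (λ x∈ → C⊆ (C′⊆C x∈)) (λ x∈ → dis (C′⊆C x∈)) ∣C′∣≡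
         (λ x∈ y∈ x≢y → match⇒indep (pairs (C′⊆C x∈) (C′⊆C y∈) x≢y))
         (λ J⊆ ind → rank≤2 (λ x∈ → C′⊆C (J⊆ x∈)) (match ind)))

corollary1p2 : (ℓ r : ℕ) → 1 ≤ ℓ → 1 ≤ r →
    (n : ℕ) (M : Matroid n) →
    IsSimple M → IsTransversal M → HasRank M r →
    ¬ (∃ λ (N : Matroid n) → N IsMinorOf M × N ≅ U 2 (ℓ + 2) (m≤n+m 2 ℓ)) →
    ∣ ground M ∣ ≤ ℓ * (r ∸ 1) + 1
-- An empty family offers no index to the elements of a basis, which is nonempty because the rank is
-- `suc k`.
corollary1p2 ℓ (suc k) 1≤ℓ _ n M simple (zero , P , presents) (B , (indB , _) , ∣B∣≡) no-minor =
  let x , x∈B = 0<∣p∣⇒Nonempty B (≤-trans (s≤s z≤n) (≤-reflexive (sym ∣B∣≡)))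
      f , _   = Equivalence.to (proj₂ presents B (indep⊆ground M indB)) indB
  in contradiction (f (x , x∈B)) λ ()
corollary1p2 ℓ (suc k) 1≤ℓ _ n M simple (suc b , P , presents) rank no-minor =
  let K , ∣K∣≡ , match = presentation-of-size-rank M presents rank
  in Matchings.bounded _ zero 1≤ℓ k ∣K∣≡ (simple⇒SimpleOn M presents match simple)
       (no-minor⇒NoLongLine M presents match no-minor)
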